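{- For $n \geq 6$ we have $\mathrm{mex}(n;2) = \left\lceil \frac{(n-1)^2}{4} \right\rceil$. For odd $n \ge 6$ the unique (up to isomorphism) graph with order $n$, mp-number $2$ and size $\mathrm{mex}(n;2)$ is $T_{n,2}^*$, whilst for even $n \ge 6$ the unique such graph (up to isomorphism) is $T_{n,2}^*$ with one edge added between its two partite sets.
   Context: All graphs are finite, simple and undirected; the order of a graph is its number of vertices and its size is its number of edges. A monophonic path is an induced (chordless) path. A set $S$ of vertices of a graph $G$ is in monophonic position if no monophonic path of $G$ contains more than two elements of $S$; the monophonic position number (mp-number) is the largest size of such a set. $\mathrm{mex}(n;2)$ is the largest possible size of a graph with order $n$ and mp-number $2$. $T_{n,2}^*$ is the graph obtained from the complete bipartite graph $K_{\lceil n/2 \rceil, \lfloor n/2 \rfloor}$ by deleting the edges of a matching of size $\lfloor n/2 \rfloor$; its partite sets are those of the complete bipartite graph. -}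

module Defs where

open import Data.Empty using (⊥)
open import Data.Fin using (Fin; toℕ; splitAt; _<?_)
open import Data.Fin.Properties as Fin using ()
open import Data.Fin.Subset using (Subset; ∣_∣)
open import Data.Fin.Subset.Properties using (_∈?_)
open import Data.List using (List; length; filter; lookup; allFin; cartesianProduct)
open import Data.List.Relation.Unary.Linked using (Linked)
open import Data.List.Relation.Unary.Unique.Propositional using (Unique)
open import Data.Nat using (ℕ; _+_; _≤_; pred; NonZero; _/_; ∣_-_∣; ⌈_/2⌉; ⌊_/2⌋)
import Data.Nat as ℕ
open import Data.Product using (∃; _×_; _,_; proj₁)
open import Data.Sum using (_⊎_; inj₁; inj₂; [_,_])
open import Data.Unit using (⊤; tt)
open import Function.Base using (_∘_)
open import Function.Bundles using (_↔_; _⇔_; Inverse)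
open import Level using (0ℓ)
open import Relation.Binary using (Rel; Symmetric; Decidable)
open import Relation.Binary.PropositionalEquality using (_≡_; _≢_; refl; sym; subst)
open import Relation.Nullary using (¬_; yes; no; ¬?; _×-dec_; _⊎-dec_)

⌈_/_⌉ : ℕ → (d : ℕ) .{{_ : NonZero d}} → ℕ
⌈ m / d ⌉ = (m + pred d) / d

-- Adjacency is decidable so that edges can be counted.
record Graph : Set₁ where
  field
    order      : ℕ
    Adj        : Rel (Fin order) 0ℓ
    Adj?       : Decidable Adj
    Adj-sym    : Symmetric Adj
    Adj-irrefl : ∀ {u} → ¬ Adj u u

  Vertex : Set
  Vertex = Fin order

  -- Each edge is listed once, as the pair (u , v) with u < v.
  edges : List (Vertex × Vertex)
  edges = filter (λ (u , v) → (u <? v) ×-dec Adj? u v)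
                 (cartesianProduct (allFin order) (allFin order))

  size : ℕ
  size = length edges

open Graph public

record _≅_ (G H : Graph) : Set where
  field
    bijection : Vertex G ↔ Vertex H
    adjacency : ∀ u v → Adj G u v ⇔ Adj H (Inverse.to bijection u) (Inverse.to bijection v)

infix 4 _≅_

IsUniqueUpToIso : (Graph → Set₁) → Graph → Set₁
IsUniqueUpToIso P H = P H × (∀ G → P G → G ≅ H)

-- A path is the list of its vertices in order.
IsPath : (G : Graph) → List (Vertex G) → Set
IsPath G p = Unique p × Linked (Adj G) p

IsChordless : (G : Graph) → List (Vertex G) → Set
IsChordless G p = ∀ i j → Adj G (lookup p i) (lookup p j) → ∣ toℕ i - toℕ j ∣ ≡ 1

IsMonophonicPath : (G : Graph) → List (Vertex G) → Set
IsMonophonicPath G p = IsPath G p × IsChordless G p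

-- Paths have no repeated vertices, so the filtered list has one entry for
-- each element of S lying on p.
InMonophonicPosition : (G : Graph) → Subset (order G) → Set
InMonophonicPosition G S =
  ∀ p → IsMonophonicPath G p → length (filter (_∈? S) p) ≤ 2

HasMpNumber : Graph → ℕ → Set
HasMpNumber G k =
  (∃ λ S → InMonophonicPosition G S × ∣ S ∣ ≡ k) ×
  (∀ S → InMonophonicPosition G S → ∣ S ∣ ≤ k)

-- IsMex n k m says that mex(n;k) = m.
IsMex : ℕ → ℕ → ℕ → Set₁
IsMex n k m =
  (∃ λ G → order G ≡ n × HasMpNumber G k × size G ≡ m) ×
  (∀ G → order G ≡ n → HasMpNumber G k → size G ≤ m)

IsExtremal : ℕ → ℕ → Graph → Set₁
IsExtremal n k G = order G ≡ n × HasMpNumber G k × IsMex n k (size G)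

module _ {a b : ℕ} where

  Opposite : Rel (Fin a ⊎ Fin b) 0ℓ
  Opposite (inj₁ _) (inj₁ _) = ⊥
  Opposite (inj₁ _) (inj₂ _) = ⊤
  Opposite (inj₂ _) (inj₁ _) = ⊤
  Opposite (inj₂ _) (inj₂ _) = ⊥

  opposite? : Decidable Opposite
  opposite? (inj₁ _) (inj₁ _) = no λ ()
  opposite? (inj₁ _) (inj₂ _) = yes tt
  opposite? (inj₂ _) (inj₁ _) = yes tt
  opposite? (inj₂ _) (inj₂ _) = no λ ()

  opposite-sym : Symmetric Opposite
  opposite-sym {inj₁ _} {inj₂ _} _ = tt
  opposite-sym {inj₂ _} {inj₁ _} _ = tt

  opposite-irrefl : ∀ {x} → ¬ Opposite x x
  opposite-irrefl {inj₁ _} ()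
  opposite-irrefl {inj₂ _} ()

  SameIndex : Rel (Fin a ⊎ Fin b) 0ℓ
  SameIndex (inj₁ i) (inj₂ j) = toℕ i ≡ toℕ j
  SameIndex (inj₂ j) (inj₁ i) = toℕ i ≡ toℕ j
  SameIndex (inj₁ _) (inj₁ _) = ⊥
  SameIndex (inj₂ _) (inj₂ _) = ⊥

  sameIndex? : Decidable SameIndex
  sameIndex? (inj₁ i) (inj₂ j) = toℕ i ℕ.≟ toℕ j
  sameIndex? (inj₂ j) (inj₁ i) = toℕ i ℕ.≟ toℕ j
  sameIndex? (inj₁ _) (inj₁ _) = no λ ()
  sameIndex? (inj₂ _) (inj₂ _) = no λ ()

  sameIndex-sym : Symmetric SameIndex
  sameIndex-sym {inj₁ _} {inj₂ _} e = e
  sameIndex-sym {inj₂ _} {inj₁ _} e = e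

  -- u and v lie in different blocks of Fin (a + b) = Fin a ⊎ Fin b.
  Across : Rel (Fin (a + b)) 0ℓ
  Across u v = Opposite (splitAt a u) (splitAt a v)

  across? : Decidable Across
  across? u v = opposite? (splitAt a u) (splitAt a v)

  across-sym : Symmetric Across
  across-sym {u} {v} = opposite-sym {splitAt a u} {splitAt a v}

  across-irrefl : ∀ {u} → ¬ Across u u
  across-irrefl {u} = opposite-irrefl {splitAt a u}

  -- The matching that joins the i-th vertex of the first block to the i-th
  -- vertex of the second block, for all i < a ⊓ b.
  Matched : Rel (Fin (a + b)) 0ℓ
  Matched u v = SameIndex (splitAt a u) (splitAt a v)

  matched? : Decidable Matched
  matched? u v = sameIndex? (splitAt a u) (splitAt a v)

  matched-sym : Symmetric Matched
  matched-sym {u} {v} = sameIndex-sym {splitAt a u} {splitAt a v}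

completeBipartite : ℕ → ℕ → Graph
completeBipartite a b = record
  { order      = a + b
  ; Adj        = Across {a} {b}
  ; Adj?       = across? {a} {b}
  ; Adj-sym    = λ {u} {v} → across-sym {a} {b} {u} {v}
  ; Adj-irrefl = λ {u} → across-irrefl {a} {b} {u}
  }

deleteEdges : (G : Graph) (M : Rel (Vertex G) 0ℓ) → Decidable M → Symmetric M → Graph
deleteEdges G M M? M-sym = record
  { order      = order G
  ; Adj        = λ u v → Adj G u v × ¬ M u v
  ; Adj?       = λ u v → Adj? G u v ×-dec ¬? (M? u v)
  ; Adj-sym    = λ (e , ¬m) → Adj-sym G e , ¬m ∘ M-sym
  ; Adj-irrefl = Adj-irrefl G ∘ proj₁
  }

addEdge : (G : Graph) (u v : Vertex G) → u ≢ v → Graph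
addEdge G u v u≢v = record
  { order      = order G
  ; Adj        = λ x y → Adj G x y ⊎ (x ≡ u × y ≡ v) ⊎ (x ≡ v × y ≡ u)
  ; Adj?       = λ x y → Adj? G x y ⊎-dec
                   ((x Fin.≟ u ×-dec y Fin.≟ v) ⊎-dec (x Fin.≟ v ×-dec y Fin.≟ u))
  ; Adj-sym    = [ inj₁ ∘ Adj-sym G
                 , [ (λ (p , q) → inj₂ (inj₂ (q , p)))
                   , (λ (p , q) → inj₂ (inj₁ (q , p))) ] ]
  ; Adj-irrefl = [ Adj-irrefl G
                 , [ (λ { (refl , q) → u≢v q })
                   , (λ { (refl , q) → u≢v (sym q) }) ] ]
  }

-- As ⌊ n /2⌋ ≤ ⌈ n /2⌉, the deleted matching has exactly ⌊ n /2⌋ edges.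
T* : ℕ → Graph
T* n = deleteEdges (completeBipartite a b) (Matched {a} {b}) (matched? {a} {b})
                   (λ {u} {v} → matched-sym {a} {b} {u} {v})
  where
  a b : ℕ
  a = ⌈ n /2⌉
  b = ⌊ n /2⌋

record CrossNonEdge (n : ℕ) : Set where
  field
    u v    : Vertex (T* n)
    across : Across {⌈ n /2⌉} {⌊ n /2⌋} u v
    nonAdj : ¬ Adj (T* n) u v

  u≢v : u ≢ v
  u≢v u≡v = across-irrefl {⌈ n /2⌉} {⌊ n /2⌋} {v}
              (subst (λ w → Across {⌈ n /2⌉} {⌊ n /2⌋} w v) u≡v across)

T*+ : (n : ℕ) → CrossNonEdge n → Graph
T*+ n e = addEdge (T* n) u v u≢v
  where open CrossNonEdge e

module Submission where

-- Let G have order n, e edges and mp-number 2.  Any three vertices lie on an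
-- induced path, so G is triangle-free and has no two vertices with the same
-- neighbourhood N as soon as a third vertex lies outside N.  If 4e ≥ (n − 1)²,
-- then Cauchy–Schwarz gives an edge u v with deg u + deg v ≥ n − 1, so N(u)
-- and N(v) are disjoint independent sets covering all vertices but at most
-- one, z.  If z has neighbours in both sets, the absence of twins gives 4e <
-- (n − 1)², except in one configuration with n = 7, where an explicit triple
-- lies on no induced path.  Otherwise G is bipartite, and since at most one
-- vertex of a part has no non-neighbour in the other part, e ≤ a b − a + 1 for
-- parts of sizes a ≥ b.  Density then forces a ≤ b + 1 and equality, so the
-- missing edges form a matching that avoids at most one vertex of each part.

open import Defs
open import Algebra.Properties.Semiring.Sum using ()
open import Data.Bool using (Bool; true; false; not; if_then_else_)
import Data.Bool.Properties as Bool
open import Data.Empty using (⊥; ⊥-elim)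
open import Data.Fin using (Fin; zero; suc; toℕ; fromℕ; fromℕ<; inject₁; lower₁; join; splitAt; _<?_)
open import Data.Fin.Permutation using (↔⇒≡)
open import Data.Fin.Properties as Fin using (any?; all?; _≟_)
open import Data.Fin.Subset using (Subset; ∣_∣; _∈_; ⁅_⁆; _∪_; inside; outside) renaming (⊥ to ∅)
open import Data.Fin.Subset.Properties using (_∈?_; x∈⁅x⁆; x∈⁅y⁆⇒x≡y; x∈p∪q⁻; x∈p∪q⁺; p⊆p∪q; p⊂q⇒∣p∣<∣q∣; ∣⁅x⁆∣≡1; ∣⊥∣≡0; ∉⊥; drop-there)
open import Data.List as List using (List; []; _∷_; length; filter; lookup; tabulate; allFin; cartesianProduct)
import Data.List.Properties as List
import Data.List.Membership.DecPropositional as DecMembership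
import Data.List.Membership.Propositional as List
open import Data.List.Membership.Propositional.Properties using (∈-filter⁻; ∈-filter⁺; ∈-lookup; ∈-allFin)
open import Data.List.Relation.Unary.All as All using (All; []; _∷_)
open import Data.List.Relation.Unary.AllPairs using ([]; _∷_)
open import Data.List.Relation.Unary.Any as Any using (here; there)
import Data.List.Relation.Unary.Any.Properties as Any
open import Data.List.Relation.Unary.Linked using (Linked; []; [-]; _∷_)
open import Data.List.Relation.Unary.Unique.Propositional using (Unique)
open import Data.List.Relation.Unary.Unique.Propositional.Properties using (filter⁺; allFin⁺)
open import Data.Nat as ℕ using (ℕ; zero; suc; _+_; _*_; _∸_; _^_; _/_; _%_; _≤_; _<_; z≤n; s≤s; _≤?_; ∣_-_∣; ⌈_/2⌉; ⌊_/2⌋)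
open import Data.Nat.DivMod using (m*n/n≡m; +-distrib-/-∣ʳ; m<n*o⇒m/o<n; m≡m%n+[m/n]*n; m%n<n; /-monoˡ-≤)
open import Data.Nat.Divisibility using (_∣_; _∤_; _∣?_; divides; n∣m*n)
open import Data.Nat.Properties hiding (_≟_; _<?_)
open import Data.Nat.Tactic.RingSolver using (solve-∀)
open import Data.Product using (∃; _×_; _,_; proj₁; proj₂)
open import Data.Sum using (_⊎_; inj₁; inj₂; [_,_]′)
open import Data.Sum.Function.Propositional using (_⊎-↔_)
open import Data.Unit using (⊤; tt)
open import Data.Vec using ([]; _∷_; here; there)
open import Function using (_∘_; id)
open import Function.Bundles using (_↔_; _⇔_; mk↔ₛ′; mk⇔; Inverse; Equivalence)
open import Function.Properties.Inverse using (↔-sym; ↔-trans)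
open import Level using (0ℓ)
open import Relation.Binary using (tri<; tri≈; tri>)
open import Relation.Binary.PropositionalEquality using (_≡_; _≢_; refl; sym; trans; cong; cong₂; subst; subst₂; module ≡-Reasoning)
open import Relation.Nullary using (¬_; Dec; yes; no; does; contradiction; ¬?; _×-dec_; _⊎-dec_)
open import Relation.Nullary.Decidable using (decidable-stable; _→-dec_; from-yes)
open import Relation.Unary using (Pred; Decidable)

open Algebra.Properties.Semiring.Sum +-*-semiring using (sum; sum-cong-≗; ∑-distrib-+; ∑-comm; *-distribˡ-sum; *-distribʳ-sum)

-- The average of deg u + deg v over the edges is at least 4e/n ≥ (n - 1)²/n > n - 2. This yields
-- only the sum n - 1, so one vertex z may stay uncovered. That vertex is the obstacle: if it has
-- neighbours c in N(v) and y in N(u), then z, c, v, u, y is a 5-cycle and G is not bipartite. Each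
-- of N(u) and N(v) is then split by adjacency to z. In each of the four classes at most one vertex
-- attains the largest possible neighbourhood, and the loss is so great that only n ≤ 7 survives.
--
-- Both extremal families have one shape, `Crown`: a complete bipartite graph minus a matching that
-- misses exactly one vertex of one side and at most one of the other. Size, mp-number and
-- isomorphism type are determined for crowns at once, and parity enters only through the order. As
-- (n - 1)² ≤ 4e holds exactly when e ≥ ⌈(n - 1)²/4⌉, the classification of dense graphs as crowns
-- settles the upper bound and the uniqueness together.

private variable
  n : ℕ
  P Q R : Pred (Fin n) 0ℓ
  f g : Fin n → ℕ

-- Sums and counting over finite types

sum-mono : (∀ i → f i ≤ g i) → sum f ≤ sum g
sum-mono {zero}  f≤g = z≤n
sum-mono {suc n} f≤g = +-mono-≤ (f≤g zero) (sum-mono (f≤g ∘ suc))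

sum-mono-tight : (∀ i → f i ≤ g i) → sum g ≤ sum f → ∀ i → f i ≡ g i
sum-mono-tight {suc n} {f} {g} f≤g Σg≤Σf = λ
  { zero    → ≤-antisym (f≤g zero) (+-cancelʳ-≤ (sum (g ∘ suc)) _ _
                (≤-trans Σg≤Σf (+-monoʳ-≤ (f zero) (sum-mono (f≤g ∘ suc)))))
  ; (suc i) → sum-mono-tight (f≤g ∘ suc) (+-cancelˡ-≤ (f zero) _ _
                (≤-trans (+-monoˡ-≤ (sum (g ∘ suc)) (f≤g zero)) Σg≤Σf)) i }

sum-const : ∀ n c → sum {n} (λ _ → c) ≡ n * c
sum-const zero    c = refl
sum-const (suc n) c = cong (c +_) (sum-const n c)

𝟙 : {A : Set} → Dec A → ℕ
𝟙 A? = if does A? then 1 else 0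

𝟙-yes : {A : Set} (A? : Dec A) → A → 𝟙 A? ≡ 1
𝟙-yes (yes _) _ = refl
𝟙-yes (no ¬a) a = contradiction a ¬a

𝟙-no : {A : Set} (A? : Dec A) → ¬ A → 𝟙 A? ≡ 0
𝟙-no (yes a) ¬a = contradiction a ¬a
𝟙-no (no _)  _  = refl

𝟙-true : {A : Set} (A? : Dec A) → 1 ≤ 𝟙 A? → A
𝟙-true (yes a) _ = a

𝟙-mono : {A B : Set} (A? : Dec A) (B? : Dec B) → (A → B) → 𝟙 A? ≤ 𝟙 B?
𝟙-mono (yes a) B? A⇒B = ≤-reflexive (sym (𝟙-yes B? (A⇒B a)))
𝟙-mono (no _)  B? A⇒B = z≤n

𝟙-⊎ : {A B C : Set} (A? : Dec A) (B? : Dec B) (C? : Dec C) → (A → B ⊎ C) → 𝟙 A? ≤ 𝟙 B? + 𝟙 C?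
𝟙-⊎ (no _)  B? C? A⇒B⊎C = z≤n
𝟙-⊎ (yes a) B? C? A⇒B⊎C with A⇒B⊎C a
... | inj₁ b = ≤-trans (≤-reflexive (sym (𝟙-yes B? b))) (m≤m+n _ _)
... | inj₂ c = ≤-trans (≤-reflexive (sym (𝟙-yes C? c))) (m≤n+m _ _)

# : Decidable P → ℕ
# P? = sum (λ i → 𝟙 (P? i))

#-mono : (P? : Decidable P) (Q? : Decidable Q) → (∀ {i} → P i → Q i) → # P? ≤ # Q?
#-mono P? Q? P⊆Q = sum-mono λ i → 𝟙-mono (P? i) (Q? i) P⊆Q

#-tight : (P? : Decidable P) (Q? : Decidable Q) → (∀ {i} → P i → Q i) → # Q? ≤ # P? → ∀ {i} → Q i → P i
#-tight P? Q? P⊆Q #Q≤#P {i} q = 𝟙-true (P? i) (≤-reflexive (sym (trans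
  (sum-mono-tight (λ i → 𝟙-mono (P? i) (Q? i) P⊆Q) #Q≤#P i) (𝟙-yes (Q? i) q))))

#-cover : (P? : Decidable P) (Q? : Decidable Q) (R? : Decidable R) → (∀ {i} → P i → Q i ⊎ R i) → # P? ≤ # Q? + # R?
#-cover P? Q? R? P⊆Q∪R = ≤-trans (sum-mono λ i → 𝟙-⊎ (P? i) (Q? i) (R? i) P⊆Q∪R)
  (≤-reflexive (∑-distrib-+ (𝟙 ∘ Q?) (𝟙 ∘ R?)))

#-split : (P? : Decidable P) (Q? : Decidable Q) →
          # P? ≡ # (λ i → P? i ×-dec Q? i) + # (λ i → P? i ×-dec ¬? (Q? i))
#-split P? Q? = trans (sum-cong-≗ pointwise) (∑-distrib-+ (λ i → 𝟙 (P? i ×-dec Q? i)) _)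
  where
  pointwise : ∀ i → 𝟙 (P? i) ≡ 𝟙 (P? i ×-dec Q? i) + 𝟙 (P? i ×-dec ¬? (Q? i))
  pointwise i with P? i | Q? i
  ... | yes _ | yes _ = refl
  ... | yes _ | no _  = refl
  ... | no _  | yes _ = refl
  ... | no _  | no _  = refl

#-none : (P? : Decidable {A = Fin n} P) → (∀ i → ¬ P i) → # P? ≡ 0
#-none {n = n} P? none = trans (sum-cong-≗ λ i → 𝟙-no (P? i) (none i)) (trans (sum-const n 0) (*-zeroʳ n))

#-singleton : (x : Fin n) → # (_≟ x) ≡ 1
#-singleton {suc n} zero    = cong suc (#-none (λ (i : Fin n) → suc i ≟ zero) λ i ())
#-singleton {suc n} (suc x) = trans
  (cong₂ _+_ (𝟙-no (zero ≟ suc x) λ ()) (sum-cong-≗ pointwise)) (#-singleton x)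
  where
  pointwise : ∀ i → 𝟙 (suc i ≟ suc x) ≡ 𝟙 (i ≟ x)
  pointwise i = ≤-antisym (𝟙-mono (suc i ≟ suc x) (i ≟ x) Fin.suc-injective) (𝟙-mono (i ≟ x) (suc i ≟ suc x) (cong suc))

#-∈ : (P? : Decidable P) {x : Fin n} → P x → 1 ≤ # P?
#-∈ P? {x} p = ≤-trans (≤-reflexive (sym (#-singleton x))) (#-mono (_≟ x) P? λ { refl → p })

#-unique : (P? : Decidable P) → (∀ {i j} → P i → P j → i ≡ j) → # P? ≤ 1
#-unique P? unique with any? P?
... | yes (x , p) = ≤-trans (#-mono P? (_≟ x) λ q → unique q p) (≤-reflexive (#-singleton x))
... | no none     = ≤-trans (≤-reflexive (#-none P? λ i p → none (i , p))) z≤n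

#-witness : (P? : Decidable P) → 1 ≤ # P? → ∃ P
#-witness P? 1≤# with any? P?
... | yes found = found
... | no none   = contradiction (≤-trans 1≤# (≤-reflexive (#-none P? λ i p → none (i , p)))) λ ()

#-except : {P : Pred (Fin n) 0ℓ} (P? : Decidable P) (x : Fin n) → # P? ≤ suc (# (λ i → P? i ×-dec ¬? (i ≟ x)))
#-except P? x = ≤-trans (#-cover P? (_≟ x) (λ i → P? i ×-dec ¬? (i ≟ x)) split) (+-monoˡ-≤ _ (≤-reflexive (#-singleton x)))
  where
  split : ∀ {i} → _ → i ≡ x ⊎ (_ × i ≢ x)
  split {i} p with i ≟ x
  ... | yes i≡x = inj₁ i≡x
  ... | no i≢x  = inj₂ (p , i≢x)

#-another : {P : Pred (Fin n) 0ℓ} (P? : Decidable P) (x : Fin n) → 2 ≤ # P? → ∃ λ w → P w × w ≢ x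
#-another P? x 2≤# = #-witness (λ i → P? i ×-dec ¬? (i ≟ x)) (≤-pred (≤-trans 2≤# (#-except P? x)))

#-third : {P : Pred (Fin n) 0ℓ} (P? : Decidable P) (x y : Fin n) → 3 ≤ # P? → ∃ λ w → P w × w ≢ x × w ≢ y
#-third P? x y 3≤# with #-another (λ i → P? i ×-dec ¬? (i ≟ x)) y (≤-pred (≤-trans 3≤# (#-except P? x)))
... | w , (p , w≢x) , w≢y = w , p , w≢x , w≢y

#-remove : {P : Pred (Fin n) 0ℓ} (P? : Decidable P) {x : Fin n} → P x → suc (# (λ i → P? i ×-dec ¬? (i ≟ x))) ≤ # P?
#-remove P? {x} p = ≤-trans (≤-reflexive (cong (_+ # rest?) (sym (#-singleton x))))
  (≤-trans (≤-reflexive (sym (∑-distrib-+ (λ i → 𝟙 (i ≟ x)) (λ i → 𝟙 (rest? i))))) (sum-mono pointwise))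
  where
  rest? = λ i → P? i ×-dec ¬? (i ≟ x)
  pointwise : ∀ i → 𝟙 (i ≟ x) + 𝟙 (rest? i) ≤ 𝟙 (P? i)
  pointwise i with P? i | i ≟ x
  ... | yes _ | yes _    = s≤s z≤n
  ... | yes _ | no _     = s≤s z≤n
  ... | no ¬p | yes refl = contradiction p ¬p
  ... | no _  | no _     = z≤n

#≤1 : {P : Pred (Fin n) 0ℓ} (P? : Decidable P) {x : Fin n} → # P? ≤ 1 → P x → ∀ {w} → P w → w ≡ x
#≤1 P? {x} #≤1 p {w} q with w ≟ x
... | yes w≡x = w≡x
... | no w≢x  = contradiction (≤-trans (s≤s (#-∈ (λ i → P? i ×-dec ¬? (i ≟ x)) (q , w≢x))) (≤-trans (#-remove P? p) #≤1)) λ { (s≤s ()) }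

#≤2 : {P : Pred (Fin n) 0ℓ} (P? : Decidable P) {x y : Fin n} → # P? ≤ 2 → P x → P y → y ≢ x →
      ∀ {w} → P w → w ≡ x ⊎ w ≡ y
#≤2 P? {x} #≤2 p q y≢x {w} r with w ≟ x
... | yes w≡x = inj₁ w≡x
... | no w≢x  = inj₂ (#≤1 (λ i → P? i ×-dec ¬? (i ≟ x)) (≤-pred (≤-trans (#-remove P? p) #≤2)) (q , y≢x) (r , w≢x))

#≤3 : {P : Pred (Fin n) 0ℓ} (P? : Decidable P) {x y z : Fin n} → # P? ≤ 3 → P x → P y → P z → y ≢ x → z ≢ x → z ≢ y →
      ∀ {w} → P w → w ≡ x ⊎ w ≡ y ⊎ w ≡ z
#≤3 P? {x} #≤3 p q r y≢x z≢x z≢y {w} s with w ≟ x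
... | yes w≡x = inj₁ w≡x
... | no w≢x  = inj₂ (#≤2 (λ i → P? i ×-dec ¬? (i ≟ x)) (≤-pred (≤-trans (#-remove P? p) #≤3)) (q , y≢x) (r , z≢x) z≢y (s , w≢x))

sumOver : {P : Pred (Fin n) 0ℓ} → Decidable P → (Fin n → ℕ) → ℕ
sumOver P? f = sum (λ i → 𝟙 (P? i) * f i)

-- The bound used for degrees: c is the size of a set containing the
-- neighbourhoods of all vertices in P, and at most one of them fills it.
module _ {P : Pred (Fin n) 0ℓ} (P? : Decidable P) (f : Fin n → ℕ) (c : ℕ) where

  private
    sumOver+# : sum (λ i → 𝟙 (P? i) * f i + 𝟙 (P? i)) ≡ sumOver P? f + # P?
    sumOver+# = ∑-distrib-+ (λ i → 𝟙 (P? i) * f i) (𝟙 ∘ P?)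

    below : (x : Fin n) → (∀ {i} → P i → f i ≤ c) → (∀ {i} → P i → f i ≡ c → i ≡ x) →
            ∀ i → 𝟙 (P? i) * f i + 𝟙 (P? i) ≤ 𝟙 (P? i) * c + 𝟙 (i ≟ x)
    below x f≤c unique i with P? i | i ≟ x
    ... | no _  | _       = z≤n
    ... | yes p | yes _   = +-monoˡ-≤ 1 (+-monoˡ-≤ 0 (f≤c p))
    ... | yes p | no i≢x  = begin
      f i + 0 + 1  ≡⟨ solve-f (f i) ⟩
      suc (f i)    ≤⟨ ≤∧≢⇒< (f≤c p) (λ fi≡c → i≢x (unique p fi≡c)) ⟩
      c            ≤⟨ m≤m+n c 0 ⟩
      c + 0        ≤⟨ m≤m+n (c + 0) 0 ⟩
      c + 0 + 0    ∎
      where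
      open ≤-Reasoning
      solve-f : ∀ x → x + 0 + 1 ≡ suc x
      solve-f = solve-∀

    Σbelow : (x : Fin n) → sum (λ i → 𝟙 (P? i) * c + 𝟙 (i ≟ x)) ≡ # P? * c + 1
    Σbelow x = trans (∑-distrib-+ (λ i → 𝟙 (P? i) * c) (λ i → 𝟙 (i ≟ x)))
                     (cong₂ _+_ (sym (*-distribʳ-sum c (𝟙 ∘ P?))) (#-singleton x))

    none-attains : (∀ {i} → P i → f i ≤ c) → ¬ (∃ λ i → P i × f i ≡ c) → sumOver P? f + # P? ≤ # P? * c
    none-attains f≤c none = begin
      sumOver P? f + # P?                    ≡⟨ sumOver+# ⟨
      sum (λ i → 𝟙 (P? i) * f i + 𝟙 (P? i))  ≤⟨ sum-mono pointwise ⟩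
      sum (λ i → 𝟙 (P? i) * c)               ≡⟨ *-distribʳ-sum c (𝟙 ∘ P?) ⟨
      # P? * c                               ∎
      where
      open ≤-Reasoning
      pointwise : ∀ i → 𝟙 (P? i) * f i + 𝟙 (P? i) ≤ 𝟙 (P? i) * c
      pointwise i with P? i
      ... | no _  = z≤n
      ... | yes p = ≤-trans (≤-reflexive (trans (cong (_+ 1) (+-identityʳ (f i))) (+-comm (f i) 1)))
                      (≤-trans (≤∧≢⇒< (f≤c p) (λ e → none (i , p , e))) (m≤m+n c 0))

  -- Every member of `P` with at most one exception satisfies f + 1 ≤ c. Adding `# P?` on the left
  -- replaces the subtraction in c - 1, and the final 1 pays for the exception.
  sumOver-≤ : (∀ {i} → P i → f i ≤ c) → (∀ {i j} → P i → P j → f i ≡ c → f j ≡ c → i ≡ j) →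
              sumOver P? f + # P? ≤ # P? * c + 1
  sumOver-≤ f≤c unique with any? (λ i → P? i ×-dec f i ℕ.≟ c)
  ... | yes (x , px , fx≡c) = begin
    sumOver P? f + # P?                    ≡⟨ sumOver+# ⟨
    sum (λ i → 𝟙 (P? i) * f i + 𝟙 (P? i))  ≤⟨ sum-mono (below x f≤c λ p e → unique p px e fx≡c) ⟩
    sum (λ i → 𝟙 (P? i) * c + 𝟙 (i ≟ x))   ≡⟨ Σbelow x ⟩
    # P? * c + 1                           ∎
    where open ≤-Reasoning
  ... | no none = ≤-trans (none-attains f≤c none) (m≤m+n _ 1)

  -- Equality of the sums forces equality in the termwise comparison. An exception must therefore
  -- exist, and every member of `P` is within one of `c`.
  sumOver-tight : (∀ {i} → P i → f i ≤ c) → (∀ {i j} → P i → P j → f i ≡ c → f j ≡ c → i ≡ j) →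
                  # P? * c + 1 ≤ sumOver P? f + # P? →
                  ∃ λ x → P x × f x ≡ c × (∀ {i} → P i → c ≤ suc (f i))
  sumOver-tight f≤c unique large with any? (λ i → P? i ×-dec f i ℕ.≟ c)
  ... | yes (x , px , fx≡c) = x , px , fx≡c , λ {i} → almost i
    where
    equal : ∀ i → 𝟙 (P? i) * f i + 𝟙 (P? i) ≡ 𝟙 (P? i) * c + 𝟙 (i ≟ x)
    equal = sum-mono-tight (below x f≤c λ p e → unique p px e fx≡c)
      (≤-trans (≤-reflexive (Σbelow x)) (≤-trans large (≤-reflexive (sym sumOver+#))))
    almost : ∀ i → P i → c ≤ suc (f i)
    almost i p with P? i | equal i
    ... | no ¬p | _ = contradiction p ¬p
    ... | yes _ | e = begin
      c                  ≤⟨ m≤m+n c _ ⟩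
      c + 0              ≤⟨ m≤m+n (c + 0) _ ⟩
      c + 0 + 𝟙 (i ≟ x)  ≡⟨ e ⟨
      f i + 0 + 1        ≡⟨ trans (cong (_+ 1) (+-identityʳ (f i))) (+-comm (f i) 1) ⟩
      suc (f i)          ∎
      where open ≤-Reasoning
  ... | no none = contradiction (≤-trans large (none-attains f≤c none)) (<⇒≱ (≤-reflexive (+-comm 1 _)))

sumOver-cover : {P Q R : Pred (Fin n) 0ℓ} (P? : Decidable P) (Q? : Decidable Q) (R? : Decidable R) (f : Fin n → ℕ) →
                (∀ {i} → P i → Q i ⊎ R i) → sumOver P? f ≤ sumOver Q? f + sumOver R? f
sumOver-cover P? Q? R? f P⊆Q∪R = ≤-trans (sum-mono λ i → ≤-trans (*-monoˡ-≤ (f i) (𝟙-⊎ (P? i) (Q? i) (R? i) P⊆Q∪R))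
    (≤-reflexive (*-distribʳ-+ (f i) (𝟙 (Q? i)) (𝟙 (R? i)))))
  (≤-reflexive (∑-distrib-+ (λ i → 𝟙 (Q? i) * f i) (λ i → 𝟙 (R? i) * f i)))

sumOver-singleton : (x : Fin n) (f : Fin n → ℕ) → sumOver (_≟ x) f ≤ f x
sumOver-singleton x f = ≤-trans (sum-mono pointwise)
  (≤-reflexive (trans (sym (*-distribʳ-sum (f x) (λ i → 𝟙 (i ≟ x)))) (trans (cong (_* f x) (#-singleton x)) (+-identityʳ (f x)))))
  where
  pointwise : ∀ i → 𝟙 (i ≟ x) * f i ≤ 𝟙 (i ≟ x) * f x
  pointwise i with i ≟ x
  ... | yes refl = ≤-refl
  ... | no _     = z≤n

-- Degrees

length-filter-tabulate : {A : Set} {P : Pred A 0ℓ} (P? : Decidable P) (f : Fin n → A) →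
                         length (filter P? (tabulate f)) ≡ sum (λ i → 𝟙 (P? (f i)))
length-filter-tabulate {zero}  P? f = refl
length-filter-tabulate {suc n} P? f with P? (f zero)
... | yes _ = cong suc (length-filter-tabulate P? (f ∘ suc))
... | no _  = length-filter-tabulate P? (f ∘ suc)

length-filter-product : {A : Set} {m : ℕ} {P : Pred (A × Fin n) 0ℓ} (P? : Decidable P) (f : Fin m → A) →
  length (filter P? (cartesianProduct (tabulate f) (allFin n))) ≡ sum (λ i → sum (λ j → 𝟙 (P? (f i , j))))
length-filter-product {m = zero}  P? f = refl
length-filter-product {n = n} {m = suc m} P? f = begin
  length (filter P? (List.map (f zero ,_) (allFin n) List.++ rest))
    ≡⟨ cong length (List.filter-++ P? (List.map (f zero ,_) (allFin n)) rest) ⟩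
  length (filter P? (List.map (f zero ,_) (allFin n)) List.++ filter P? rest)
    ≡⟨ List.length-++ (filter P? (List.map (f zero ,_) (allFin n))) ⟩
  length (filter P? (List.map (f zero ,_) (allFin n))) + length (filter P? rest)
    ≡⟨ cong₂ _+_ (trans (cong (length ∘ filter P?) (List.map-tabulate id (f zero ,_)))
                        (length-filter-tabulate P? (f zero ,_)))
                 (length-filter-product P? (f ∘ suc)) ⟩
  sum (λ i → sum (λ j → 𝟙 (P? (f i , j)))) ∎
  where
  open ≡-Reasoning
  rest = cartesianProduct (tabulate (f ∘ suc)) (allFin n)

2xy≤x²+y² : ∀ x y → 2 * (x * y) ≤ x * x + y * y
2xy≤x²+y² x y = [ ordered x y , (λ y≤x → begin
    2 * (x * y)    ≡⟨ cong (2 *_) (*-comm x y) ⟩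
    2 * (y * x)    ≤⟨ ordered y x y≤x ⟩
    y * y + x * x  ≡⟨ +-comm (y * y) (x * x) ⟩
    x * x + y * y  ∎) ]′ (≤-total x y)
  where
  open ≤-Reasoning
  square : ∀ x k → 2 * (x * (x + k)) + k * k ≡ x * x + (x + k) * (x + k)
  square = solve-∀
  ordered : ∀ x y → x ≤ y → 2 * (x * y) ≤ x * x + y * y
  ordered x y x≤y = subst (λ y → 2 * (x * y) ≤ x * x + y * y) (m+[n∸m]≡n x≤y)
    (≤-trans (m≤m+n _ _) (≤-reflexive (square x (y ∸ x))))

module _ (f : Fin n → ℕ) where

  sum-product : sum (λ i → sum (λ j → f i * f j)) ≡ sum f * sum f
  sum-product = trans (sum-cong-≗ λ i → sym (*-distribˡ-sum (f i) f)) (sym (*-distribʳ-sum (sum f) f))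

  -- Sum 2 f(i) f(j) ≤ f(i)² + f(j)² over all ordered pairs; each square then occurs n times from
  -- either index.
  cauchy-schwarz : sum f * sum f ≤ n * sum (λ i → f i * f i)
  cauchy-schwarz = *-cancelˡ-≤ 2 (begin
    2 * (sum f * sum f)                              ≡⟨ cong (2 *_) sum-product ⟨
    2 * sum (λ i → sum (λ j → f i * f j))            ≡⟨ *-distribˡ-sum 2 (λ i → sum (λ j → f i * f j)) ⟩
    sum (λ i → 2 * sum (λ j → f i * f j))            ≡⟨ sum-cong-≗ (λ i → *-distribˡ-sum 2 (λ j → f i * f j)) ⟩
    sum (λ i → sum (λ j → 2 * (f i * f j)))          ≤⟨ sum-mono (λ i → sum-mono λ j → 2xy≤x²+y² (f i) (f j)) ⟩
    sum (λ i → sum (λ j → f i * f i + f j * f j))    ≡⟨ sum-cong-≗ (λ i → trans (∑-distrib-+ (λ _ → f i * f i) (λ j → f j * f j))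
                                                          (cong (_+ q) (sum-const n (f i * f i)))) ⟩
    sum (λ i → n * (f i * f i) + q)                  ≡⟨ ∑-distrib-+ (λ i → n * (f i * f i)) (λ _ → q) ⟩
    sum (λ i → n * (f i * f i)) + sum {n} (λ _ → q)  ≡⟨ cong₂ _+_ (sym (*-distribˡ-sum n (λ i → f i * f i))) (sum-const n q) ⟩
    n * q + n * q                                    ≡⟨ double (n * q) ⟩
    2 * (n * q)                                      ∎)
    where
    open ≤-Reasoning
    q = sum (λ i → f i * f i)
    double : ∀ x → x + x ≡ 2 * x
    double = solve-∀

deg : (G : Graph) → Vertex G → ℕ
deg G u = # (Adj? G u)

module _ (G : Graph) where

  private
    N = order G

    adj : Vertex G → Vertex G → ℕ
    adj u v = 𝟙 (Adj? G u v)

  -- `size` lists an edge only in the orientation with u < v, so the adjacency matrix is written as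
  -- its upper triangle plus the transpose of that triangle.
  handshake : sum (deg G) ≡ 2 * size G
  handshake = begin
    sum (deg G)                                    ≡⟨ sum-cong-≗ (λ u → trans (sum-cong-≗ (orient u)) (∑-distrib-+ (up u) (λ v → up v u))) ⟩
    sum (λ u → sum (up u) + sum (λ v → up v u))    ≡⟨ ∑-distrib-+ (λ u → sum (up u)) (λ u → sum (λ v → up v u)) ⟩
    s + sum (λ u → sum (λ v → up v u))             ≡⟨ cong (s +_) (∑-comm (λ u v → up v u)) ⟩
    s + s                                          ≡⟨ double s ⟩
    2 * s                                          ≡⟨ cong (2 *_) (length-filter-product (λ (u , v) → (u <? v) ×-dec Adj? G u v) id) ⟨
    2 * size G                                     ∎
    where
    open ≡-Reasoning
    up : Vertex G → Vertex G → ℕ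
    up u v = 𝟙 ((u <? v) ×-dec Adj? G u v)
    s = sum (λ u → sum (up u))
    double : ∀ x → x + x ≡ 2 * x
    double = solve-∀
    orient : ∀ u v → adj u v ≡ up u v + up v u
    orient u v with Adj? G u v
    ... | no ¬uv = sym (cong₂ _+_ (𝟙-no ((u <? v) ×-dec no ¬uv) (¬uv ∘ proj₂)) (𝟙-no ((v <? u) ×-dec Adj? G v u) (¬uv ∘ Adj-sym G ∘ proj₂)))
    ... | yes uv with Fin.<-cmp u v
    ...   | tri< u<v _ v≮u = sym (cong₂ _+_ (𝟙-yes ((u <? v) ×-dec yes uv) (u<v , uv)) (𝟙-no ((v <? u) ×-dec Adj? G v u) (v≮u ∘ proj₁)))
    ...   | tri≈ _ refl _  = contradiction uv (Adj-irrefl G)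
    ...   | tri> u≮v _ v<u = sym (cong₂ _+_ (𝟙-no ((u <? v) ×-dec yes uv) (u≮v ∘ proj₁)) (𝟙-yes ((v <? u) ×-dec Adj? G v u) (v<u , Adj-sym G uv)))

  -- Averaging deg u + deg v over the edges gives Σ deg² / size, which
  -- Cauchy–Schwarz bounds below by 4 size / n.
  heavy-edge : 2 ≤ N → (N ∸ 1) ^ 2 ≤ 4 * size G → ∃ λ u → ∃ λ v → Adj G u v × N ≤ suc (deg G u + deg G v)
  heavy-edge 2≤N dense with any? (λ u → any? λ v → Adj? G u v ×-dec (N ≤? suc (deg G u + deg G v)))
  ... | yes found = found
  ... | no none   = ⊥-elim (bound (sum (deg G)) N 2≤N dense′ all-light)
    where
    open ≤-Reasoning
    d = deg G
    S = sum d
    q = sum (λ u → d u * d u)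
    dense′ : (N ∸ 1) * (N ∸ 1) ≤ 2 * S
    dense′ = begin
      (N ∸ 1) * (N ∸ 1)  ≡⟨ cong ((N ∸ 1) *_) (sym (*-identityʳ (N ∸ 1))) ⟩
      (N ∸ 1) ^ 2        ≤⟨ dense ⟩
      4 * size G         ≡⟨ *-assoc 2 2 (size G) ⟩
      2 * (2 * size G)   ≡⟨ cong (2 *_) handshake ⟨
      2 * S              ∎
    -- Without a heavy edge, deg u + deg v + 2 ≤ N on every edge. The factors `adj` make both sides
    -- vanish elsewhere, and `adj v u` in front of `d v` lets the double sum be transposed.
    light : ∀ u v → adj u v * d u + adj v u * d v + 2 * adj u v ≤ adj u v * N
    light u v with Adj? G u v | Adj? G v u
    ... | yes uv | no ¬vu = contradiction (Adj-sym G uv) ¬vu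
    ... | no ¬uv | yes vu = contradiction (Adj-sym G vu) ¬uv
    ... | no _   | no _   = z≤n
    ... | yes uv | yes _  = begin
      d u + 0 + (d v + 0) + 2  ≡⟨ ring (d u) (d v) ⟩
      suc (suc (d u + d v))    ≤⟨ ≰⇒> (λ large → none (u , v , uv , large)) ⟩
      N                        ≡⟨ +-identityʳ N ⟨
      N + 0                    ∎
      where
      ring : ∀ x y → x + 0 + (y + 0) + 2 ≡ suc (suc (x + y))
      ring = solve-∀
    weighted : sum (λ u → sum (λ v → adj u v * d u)) ≡ q
    weighted = sum-cong-≗ λ u → sym (*-distribʳ-sum (d u) (adj u))
    all-light : 2 * (S * S) + 2 * (N * S) ≤ N * (S * N)
    all-light = begin
      2 * (S * S) + 2 * (N * S)      ≤⟨ +-monoˡ-≤ _ (*-monoʳ-≤ 2 (cauchy-schwarz d)) ⟩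
      2 * (N * q) + 2 * (N * S)      ≡⟨ ring N q S ⟩
      N * (q + q + 2 * S)            ≡⟨ cong (N *_) expand ⟨
      N * sum (λ u → sum (λ v → adj u v * d u + adj v u * d v + 2 * adj u v))
                                     ≤⟨ *-monoʳ-≤ N (sum-mono λ u → sum-mono (light u)) ⟩
      N * sum (λ u → sum (λ v → adj u v * N))
                                     ≡⟨ cong (N *_) (trans (sum-cong-≗ λ u → sym (*-distribʳ-sum N (adj u))) (sym (*-distribʳ-sum N d))) ⟩
      N * (S * N)                    ∎
      where
      ring : ∀ n q s → 2 * (n * q) + 2 * (n * s) ≡ n * (q + q + 2 * s)
      ring = solve-∀
      expand : sum (λ u → sum (λ v → adj u v * d u + adj v u * d v + 2 * adj u v)) ≡ q + q + 2 * S
      expand = trans (sum-cong-≗ λ u → trans (∑-distrib-+ (λ v → adj u v * d u + adj v u * d v) (λ v → 2 * adj u v))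
                       (cong₂ _+_ (∑-distrib-+ (λ v → adj u v * d u) (λ v → adj v u * d v)) (sym (*-distribˡ-sum 2 (adj u)))))
               (trans (∑-distrib-+ (λ u → sum (λ v → adj u v * d u) + sum (λ v → adj v u * d v)) (λ u → 2 * d u))
                 (cong₂ _+_ (trans (∑-distrib-+ (λ u → sum (λ v → adj u v * d u)) (λ u → sum (λ v → adj v u * d v)))
                              (cong₂ _+_ weighted (trans (∑-comm (λ u v → adj v u * d v)) weighted)))
                            (sym (*-distribˡ-sum 2 d))))
    -- Dividing by s leaves 2s + 2n ≤ n², while density gives 2s + 2n ≥ (n - 1)² + 2n = n² + 1. From
    -- 2 ≤ n and density, s is positive.
    bound : ∀ s n → 2 ≤ n → (n ∸ 1) * (n ∸ 1) ≤ 2 * s → 2 * (s * s) + 2 * (n * s) ≤ n * (s * n) → ⊥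
    bound zero    (suc (suc m)) _ () _
    bound zero    (suc zero) (s≤s ())
    bound (suc s) (suc m) _ dense light = <⇒≱ (begin-strict
      suc m * suc m                  ≡⟨ square m ⟩
      m * m + (1 + 2 * m)            <⟨ +-monoʳ-< (m * m) (≤-reflexive (step m)) ⟩
      m * m + 2 * suc m              ≤⟨ +-monoˡ-≤ (2 * suc m) dense ⟩
      2 * suc s + 2 * suc m          ∎) cancelled
      where
      square : ∀ m → suc m * suc m ≡ m * m + (1 + 2 * m)
      square = solve-∀
      step : ∀ m → suc (1 + 2 * m) ≡ 2 * suc m
      step = solve-∀
      lhs : ∀ s m → (2 * suc s + 2 * suc m) * suc s ≡ 2 * (suc s * suc s) + 2 * (suc m * suc s)
      lhs = solve-∀
      rhs : ∀ s m → suc m * (suc s * suc m) ≡ suc m * suc m * suc s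
      rhs = solve-∀
      cancelled : 2 * suc s + 2 * suc m ≤ suc m * suc m
      cancelled = *-cancelʳ-≤ (2 * suc s + 2 * suc m) (suc m * suc m) (suc s)
        (≤-trans (≤-reflexive (lhs s m)) (≤-trans light (≤-reflexive (rhs s m))))

-- Induced paths

two-values : {A : Set} {x y : A} {xs : List A} → Unique xs → (∀ {v} → v List.∈ xs → v ≡ x ⊎ v ≡ y) → length xs ≤ 2
two-values {xs = []}             _ _ = z≤n
two-values {xs = _ ∷ []}         _ _ = s≤s z≤n
two-values {xs = _ ∷ _ ∷ []}     _ _ = s≤s (s≤s z≤n)
two-values {xs = a ∷ b ∷ c ∷ xs} ((a≢b ∷ a≢c ∷ _) ∷ (b≢c ∷ _) ∷ _) among
  with among (here refl) | among (there (here refl)) | among (there (there (here refl)))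
... | inj₁ refl | inj₁ refl | _         = contradiction refl a≢b
... | inj₂ refl | inj₂ refl | _         = contradiction refl a≢b
... | inj₁ refl | inj₂ refl | inj₁ refl = contradiction refl a≢c
... | inj₁ refl | inj₂ refl | inj₂ refl = contradiction refl b≢c
... | inj₂ refl | inj₁ refl | inj₁ refl = contradiction refl b≢c
... | inj₂ refl | inj₁ refl | inj₂ refl = contradiction refl a≢c

module _ (G : Graph) where

  -- Positions are natural numbers related to vertices, not indices into a list. Arguments can then
  -- match on a position being 0, 1, 2 or later, and reversal only renumbers.
  record InducedPath : Set₁ where
    field
      len        : ℕ
      At         : ℕ → Vertex G → Set
      bounded    : ∀ {k v} → At k v → k < len
      total      : ∀ {k} → k < len → ∃ (At k)
      functional : ∀ {k v w} → At k v → At k w → v ≡ w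
      linked     : ∀ {k v w} → At k v → At (suc k) w → Adj G v w
      chordless  : ∀ {k l v w} → At k v → At l w → Adj G v w → k ≡ suc l ⊎ l ≡ suc k

  open InducedPath

  private
    distance-1 : ∀ m n → ∣ m - n ∣ ≡ 1 → m ≡ suc n ⊎ n ≡ suc m
    distance-1 zero    (suc zero) _ = inj₂ refl
    distance-1 (suc zero) zero    _ = inj₁ refl
    distance-1 (suc m) (suc n)    e with distance-1 m n e
    ... | inj₁ p = inj₁ (cong suc p)
    ... | inj₂ p = inj₂ (cong suc p)

    linked-lookup : ∀ {p} → Linked (Adj G) p → ∀ i j → toℕ j ≡ suc (toℕ i) → Adj G (lookup p i) (lookup p j)
    linked-lookup (r ∷ _)  zero    (suc zero) _ = r
    linked-lookup (_ ∷ rs) (suc i) (suc j)    e = linked-lookup rs i j (suc-injective e)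

  fromList : ∀ p → IsMonophonicPath G p → InducedPath
  fromList p ((_ , linked-p) , chordless-p) = record
    { len        = length p
    ; At         = λ k v → ∃ λ i → toℕ i ≡ k × lookup p i ≡ v
    ; bounded    = λ { (i , refl , _) → Fin.toℕ<n i }
    ; total      = λ k<len → _ , fromℕ< k<len , Fin.toℕ-fromℕ< k<len , refl
    ; functional = λ { (i , i≡k , refl) (j , j≡k , refl) → cong (lookup p) (Fin.toℕ-injective (trans i≡k (sym j≡k))) }
    ; linked     = λ { (i , refl , refl) (j , j≡1+i , refl) → linked-lookup linked-p i j j≡1+i }
    ; chordless  = λ { (i , refl , refl) (j , refl , refl) uv → distance-1 (toℕ i) (toℕ j) (chordless-p i j uv) }
    }

  reverse : InducedPath → InducedPath
  reverse π = record
    { len        = len π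
    ; At         = λ k v → ∃ λ l → suc (k + l) ≡ len π × At π l v
    ; bounded    = λ { {k} (l , e , _) → ≤-trans (s≤s (m≤m+n k l)) (≤-reflexive e) }
    ; total      = λ {k} k<len → let l<len = opposite< k k<len in
                     _ , len π ∸ suc k , m+[n∸m]≡n k<len , proj₂ (total π l<len)
    ; functional = λ { {k} (l , e , a) (l′ , e′ , a′) → functional π a
                     (subst (λ m → At π m _) (+-cancelˡ-≡ (suc k) l′ l (trans e′ (sym e))) a′) }
    ; linked     = λ { {k} (l , e , a) (l′ , e′ , a′) → Adj-sym G (linked π a′
                     (subst (λ m → At π m _) (+-cancelˡ-≡ (suc k) l (suc l′)
                       (trans e (trans (sym e′) (cong suc (sym (+-suc k l′)))))) a)) }
    ; chordless  = λ { (l , e , a) (l′ , e′ , a′) vw →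
                     [ inj₂ ∘ mirror (trans e (sym e′)) , inj₁ ∘ mirror (trans e′ (sym e)) ]′ (chordless π a a′ vw) }
    }
    where
    opposite< : ∀ k → k < len π → len π ∸ suc k < len π
    opposite< k k<len = ∸-monoʳ-< (s≤s z≤n) k<len
    mirror : {k k′ l l′ : ℕ} → suc (k + l) ≡ suc (k′ + l′) → l ≡ suc l′ → k′ ≡ suc k
    mirror {k} {k′} {l′ = l′} e refl = +-cancelʳ-≡ l′ k′ (suc k) (sym (trans (sym (+-suc k l′)) (suc-injective e)))

  reverse-at : ∀ π {k v} → At π k v → ∃ λ l → suc (l + k) ≡ len π × At (reverse π) l v
  reverse-at π {k} a = l , e , k , e , a
    where
    l = len π ∸ suc k
    e : suc (l + k) ≡ len π
    e = trans (sym (+-suc l k)) (m∸n+n≡m (bounded π a))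

  Dominates : Vertex G → Vertex G → Set
  Dominates t s = ∀ {y} → Adj G s y → Adj G t y

  -- The successor and the predecessor of s on the path are adjacent to t, so
  -- t comes two places after s, and s has no predecessor.
  dominated-at-start : ∀ π {i j s t} → At π i s → At π j t → i < j → Dominates t s → i ≡ 0 × j ≡ 2
  dominated-at-start π {i} ai aj i<j dom with total π (<-≤-trans (s≤s i<j) (bounded π aj))
  ... | y , ay with chordless π aj ay (dom (linked π ai ay))
  ...   | inj₂ refl = contradiction i<j (<-irrefl refl)
  ...   | inj₁ refl with i
  ...     | zero   = refl , refl
  ...     | suc i′ with total π {i′} (<-trans ≤-refl (bounded π ai))
  ...       | y′ , ay′ with chordless π aj ay′ (dom (Adj-sym G (linked π ay′ ai)))
  ...         | inj₁ ()
  ...         | inj₂ ()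

  module _ (mp₂ : HasMpNumber G 2) where

    -- If no induced path meets all of x, y and z, then the three-element set they form is in
    -- monophonic position, which contradicts the upper bound 2.
    some-path : ∀ {x y z} → x ≢ y → x ≢ z → y ≢ z →
                (∀ (π : InducedPath) {i j k} → At π i x → At π j y → At π k z → ⊥) → ⊥
    some-path {x} {y} {z} x≢y x≢z y≢z none = <⇒≱ three≤∣S∣ (proj₂ mp₂ S position)
      where
      open DecMembership (_≟_ {n = order G}) using () renaming (_∈?_ to _∈ₗ?_)
      S = (⁅ x ⁆ ∪ ⁅ y ⁆) ∪ ⁅ z ⁆
      ∈S⁻ : ∀ {v} → v ∈ S → v ≡ x ⊎ v ≡ y ⊎ v ≡ z
      ∈S⁻ v∈S with x∈p∪q⁻ (⁅ x ⁆ ∪ ⁅ y ⁆) ⁅ z ⁆ v∈S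
      ... | inj₂ v∈z = inj₂ (inj₂ (x∈⁅y⁆⇒x≡y z v∈z))
      ... | inj₁ v∈xy with x∈p∪q⁻ ⁅ x ⁆ ⁅ y ⁆ v∈xy
      ...   | inj₁ v∈x = inj₁ (x∈⁅y⁆⇒x≡y x v∈x)
      ...   | inj₂ v∈y = inj₂ (inj₁ (x∈⁅y⁆⇒x≡y y v∈y))
      three≤∣S∣ : 3 ≤ ∣ S ∣
      three≤∣S∣ = ≤-trans (s≤s (≤-trans (s≤s (≤-reflexive (sym (∣⁅x⁆∣≡1 x))))
          (p⊂q⇒∣p∣<∣q∣ (p⊆p∪q ⁅ y ⁆ , y , x∈p∪q⁺ (inj₂ (x∈⁅x⁆ y)) , λ y∈x → x≢y (sym (x∈⁅y⁆⇒x≡y x y∈x))))))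
        (p⊂q⇒∣p∣<∣q∣ (p⊆p∪q ⁅ z ⁆ , z , x∈p∪q⁺ (inj₂ (x∈⁅x⁆ z)) , λ z∈xy →
          [ (λ z∈x → x≢z (sym (x∈⁅y⁆⇒x≡y x z∈x))) , (λ z∈y → y≢z (sym (x∈⁅y⁆⇒x≡y y z∈y))) ]′ (x∈p∪q⁻ ⁅ x ⁆ ⁅ y ⁆ z∈xy)))
      at : ∀ {v p} → (mono : IsMonophonicPath G p) → v List.∈ p → ∃ λ k → At (fromList p mono) k v
      at mono v∈p = _ , Any.index v∈p , refl , sym (Any.lookup-index v∈p)
      position : InMonophonicPosition G S
      position p mono@((unique , _) , _) = avoid (x ∈ₗ? p) (y ∈ₗ? p) (z ∈ₗ? p)
        where
        on-p : ∀ {v} → v List.∈ filter (_∈? S) p → v List.∈ p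
        on-p v∈ = proj₁ (∈-filter⁻ (_∈? S) v∈)
        in-S : ∀ {v} → v List.∈ filter (_∈? S) p → v ≡ x ⊎ v ≡ y ⊎ v ≡ z
        in-S v∈ = ∈S⁻ (proj₂ (∈-filter⁻ (_∈? S) {xs = p} v∈))
        avoid : Dec (x List.∈ p) → Dec (y List.∈ p) → Dec (z List.∈ p) → length (filter (_∈? S) p) ≤ 2
        avoid (yes x∈p) (yes y∈p) (yes z∈p) =
          ⊥-elim (none (fromList p mono) (proj₂ (at mono x∈p)) (proj₂ (at mono y∈p)) (proj₂ (at mono z∈p)))
        avoid (no x∉p) _ _ = two-values {x = y} {z} (filter⁺ (_∈? S) unique) λ v∈ →
          [ (λ { refl → contradiction (on-p v∈) x∉p }) , id ]′ (in-S v∈)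
        avoid (yes _) (no y∉p) _ = two-values {x = x} {z} (filter⁺ (_∈? S) unique) λ v∈ →
          [ inj₁ , [ (λ { refl → contradiction (on-p v∈) y∉p }) , inj₂ ]′ ]′ (in-S v∈)
        avoid (yes _) (yes _) (no z∉p) = two-values {x = x} {y} (filter⁺ (_∈? S) unique) λ v∈ →
          [ inj₁ , [ inj₂ , (λ { refl → contradiction (on-p v∈) z∉p }) ]′ ]′ (in-S v∈)

    private
      adj⇒≢ : ∀ {u v} → Adj G u v → u ≢ v
      adj⇒≢ uv refl = Adj-irrefl G uv

    -- On an induced path, three pairwise adjacent vertices would need three pairwise consecutive
    -- positions.
    triangle-free : ∀ {x y z} → Adj G x y → Adj G y z → Adj G x z → ⊥
    triangle-free xy yz xz = some-path (adj⇒≢ xy) (adj⇒≢ xz) (adj⇒≢ yz) λ π ax ay az →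
      impossible (chordless π ax ay xy) (chordless π ay az yz) (chordless π ax az xz)
      where
      impossible : ∀ {i j k} → i ≡ suc j ⊎ j ≡ suc i → j ≡ suc k ⊎ k ≡ suc j → i ≡ suc k ⊎ k ≡ suc i → ⊥
      impossible (inj₁ refl) (inj₁ refl) (inj₁ ())
      impossible (inj₁ refl) (inj₁ refl) (inj₂ ())
      impossible (inj₁ refl) (inj₂ refl) (inj₁ ())
      impossible (inj₁ refl) (inj₂ refl) (inj₂ ())
      impossible (inj₂ refl) (inj₁ refl) (inj₁ ())
      impossible (inj₂ refl) (inj₁ refl) (inj₂ ())
      impossible (inj₂ refl) (inj₂ refl) (inj₁ ())
      impossible (inj₂ refl) (inj₂ refl) (inj₂ ())

    -- Twins dominate each other, so whichever comes first on a path is at position 0 and the other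
    -- at position 2. As `r` is not adjacent to the first, it comes later; but then the vertex at
    -- position 3 is a neighbour of both twins and has a chord to position 0.
    twin-free : ∀ {s t r} → s ≢ t → r ≢ s → r ≢ t → ¬ Adj G s r → Dominates t s → Dominates s t → ⊥
    twin-free {s} {t} {r} s≢t r≢s r≢t s≁r s≼t t≼s = some-path s≢t (r≢s ∘ sym) (r≢t ∘ sym) impossible
      where
      ordered : ∀ π {i j k s t} → At π i s → At π j t → At π k r → i < j →
                r ≢ s → r ≢ t → ¬ Adj G s r → Dominates t s → Dominates s t → ⊥
      ordered π {k = k} ai aj ak i<j r≢s r≢t s≁r s≼t t≼s with dominated-at-start π ai aj i<j s≼t
      ... | refl , refl with k
      ...   | 0 = r≢s (functional π ak ai)
      ...   | 1 = s≁r (linked π ai ak)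
      ...   | 2 = r≢t (functional π ak aj)
      ...   | suc (suc (suc _)) with total π {3} (≤-<-trans (s≤s (s≤s (s≤s z≤n))) (bounded π ak))
      ...     | y , ay with chordless π ai ay (t≼s (linked π aj ay))
      ...       | inj₁ ()
      ...       | inj₂ ()
      impossible : ∀ π {i j k} → At π i s → At π j t → At π k r → ⊥
      impossible π {i} {j} ai aj ak with <-cmp i j
      ... | tri< i<j _ _  = ordered π ai aj ak i<j r≢s r≢t s≁r s≼t t≼s
      ... | tri≈ _ refl _ = s≢t (functional π ai aj)
      ... | tri> _ _ j<i  = ordered π aj ai ak j<i r≢t r≢s (s≁r ∘ t≼s) t≼s s≼t

    -- A path through s, t and r would have to start s , w₁ or w₂ , t , y , c.
    no-detour : ∀ {s t r y c w₁ w₂} → s ≢ t → r ≢ s → r ≢ t → ¬ Adj G t r → Dominates t s →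
                (∀ {v} → Adj G s v → v ≡ w₁ ⊎ v ≡ w₂) →
                (∀ {v} → Adj G t v → v ≡ y ⊎ Adj G s v) →
                (∀ {v} → Adj G y v → v ≡ t ⊎ v ≡ c) →
                Adj G w₁ c → Adj G w₂ r → ⊥
    no-detour {s} {t} {r} {y} {c} {w₁} {w₂} s≢t r≢s r≢t t≁r s≼t N[s] N[t] N[y] w₁c w₂r =
      some-path s≢t (r≢s ∘ sym) (r≢t ∘ sym) impossible
      where
      ordered : ∀ π {i j k} → At π i s → At π j t → At π k r → i < j → ⊥
      ordered π {k = k} a₀ a₂ ak i<j with dominated-at-start π a₀ a₂ i<j s≼t
      ... | refl , refl with k
      ...   | 0 = r≢s (functional π ak a₀)
      ...   | 1 = t≁r (Adj-sym G (linked π ak a₂))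
      ...   | 2 = r≢t (functional π ak a₂)
      ...   | 3 = t≁r (linked π a₂ ak)
      -- Position 3 holds `y`, since a neighbour of `s` there would give a chord, and so position 4
      -- holds `c`. At position 1, `w₁` has a chord to `c`, and `w₂` has one to `r`, which is at
      -- position 4 or later.
      ...   | suc (suc (suc (suc _)))
        with total π {1} (<-trans (s≤s (s≤s z≤n)) (bounded π ak))
           | total π {3} (<-trans (s≤s (s≤s (s≤s (s≤s z≤n)))) (bounded π ak))
           | total π {4} (≤-<-trans (s≤s (s≤s (s≤s (s≤s z≤n)))) (bounded π ak))
      ...     | _ , a₁ | _ , a₃ | _ , a₄ with N[t] (linked π a₂ a₃)
      ...       | inj₂ sv with chordless π a₀ a₃ sv
      ...         | inj₁ ()
      ...         | inj₂ ()
      ordered π a₀ a₂ ak i<j | refl , refl | suc (suc (suc (suc _))) | _ , a₁ | _ , a₃ | _ , a₄ | inj₁ refl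
        with N[y] (linked π a₃ a₄)
      ...       | inj₁ refl with chordless π a₁ a₄ (linked π a₁ a₂)
      ...         | inj₁ ()
      ...         | inj₂ ()
      ordered π a₀ a₂ ak i<j | refl , refl | suc (suc (suc (suc _))) | _ , a₁ | _ , a₃ | _ , a₄ | inj₁ refl | inj₂ refl
        with N[s] (linked π a₀ a₁)
      ...       | inj₁ refl with chordless π a₁ a₄ w₁c
      ...         | inj₁ ()
      ...         | inj₂ ()
      ordered π a₀ a₂ ak i<j | refl , refl | suc (suc (suc (suc _))) | _ , a₁ | _ , a₃ | _ , a₄ | inj₁ refl | inj₂ refl | inj₂ refl
        with chordless π a₁ ak w₂r
      ...         | inj₁ ()
      ...         | inj₂ ()
      impossible : ∀ π {i j k} → At π i s → At π j t → At π k r → ⊥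
      impossible π {i} {j} ai aj ak with <-cmp i j
      ... | tri< i<j _ _  = ordered π ai aj ak i<j
      ... | tri≈ _ refl _ = s≢t (functional π ai aj)
      -- The roles of `s` and `t` are not symmetric, so when `t` comes first the path is reversed.
      ... | tri> _ _ j<i with reverse-at π ai | reverse-at π aj | reverse-at π ak
      ...   | i′ , ei , bi | j′ , ej , bj | _ , _ , bk = ordered (reverse π) bi bj bk
        (≰⇒> λ j′≤i′ → <-irrefl (trans ej (sym ei)) (s≤s (+-mono-≤-< j′≤i′ j<i)))

-- Bipartite graphs and crowns

≢-not : ∀ {s t} → s ≢ t → t ≡ not s
≢-not s≢t = Bool.¬-not (s≢t ∘ sym)

not-≢ : ∀ {s t} → t ≡ not s → s ≢ t
not-≢ t≡¬s s≡t = Bool.not-¬ (sym s≡t) t≡¬s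

module Bipartite (G : Graph) (side : Vertex G → Bool) (crosses : ∀ {u v} → Adj G u v → side u ≢ side v) where

  On? : ∀ s → Decidable (λ v → side v ≡ s)
  On? s v = side v Bool.≟ s

  part : Bool → ℕ
  part s = # (On? s)

  parts : part true + part false ≡ order G
  parts = trans (sym (∑-distrib-+ (λ v → 𝟙 (On? true v)) (λ v → 𝟙 (On? false v))))
    (trans (sum-cong-≗ one) (trans (sum-const (order G) 1) (*-identityʳ _)))
    where
    one : ∀ v → 𝟙 (On? true v) + 𝟙 (On? false v) ≡ 1
    one v with side v
    ... | true  = refl
    ... | false = refl

  -- Counting the edges from either side gives the same number, and the two counts add up to twice
  -- the size.
  side-degrees : ∀ s → sumOver (On? s) (deg G) ≡ size G
  side-degrees s = *-cancelˡ-≡ _ _ 2 (trans (cong (sumOver (On? s) (deg G) +_) (+-identityʳ _))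
    (trans (sym (split s)) (handshake G)))
    where
    open ≡-Reasoning
    swap : ∀ s → sumOver (On? s) (deg G) ≡ sumOver (On? (not s)) (deg G)
    swap s = begin
      sumOver (On? s) (deg G)
        ≡⟨ sum-cong-≗ (λ u → *-distribˡ-sum (𝟙 (On? s u)) (λ v → 𝟙 (Adj? G u v))) ⟩
      sum (λ u → sum (λ v → 𝟙 (On? s u) * 𝟙 (Adj? G u v)))
        ≡⟨ sum-cong-≗ (λ u → sum-cong-≗ (flip u)) ⟩
      sum (λ u → sum (λ v → 𝟙 (On? (not s) v) * 𝟙 (Adj? G v u)))
        ≡⟨ ∑-comm (λ u v → 𝟙 (On? (not s) v) * 𝟙 (Adj? G v u)) ⟩
      sum (λ v → sum (λ u → 𝟙 (On? (not s) v) * 𝟙 (Adj? G v u)))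
        ≡⟨ sum-cong-≗ (λ v → *-distribˡ-sum (𝟙 (On? (not s) v)) (λ u → 𝟙 (Adj? G v u))) ⟨
      sumOver (On? (not s)) (deg G) ∎
      where
      flip : ∀ u v → 𝟙 (On? s u) * 𝟙 (Adj? G u v) ≡ 𝟙 (On? (not s) v) * 𝟙 (Adj? G v u)
      flip u v with Adj? G u v | Adj? G v u
      ... | yes uv | no ¬vu = contradiction (Adj-sym G uv) ¬vu
      ... | no ¬uv | yes vu = contradiction (Adj-sym G vu) ¬uv
      ... | no _   | no _   = trans (*-zeroʳ (𝟙 (On? s u))) (sym (*-zeroʳ (𝟙 (On? (not s) v))))
      ... | yes uv | yes _  = cong (_* 1) (≤-antisym
        (𝟙-mono (On? s u) (On? (not s) v) λ { refl → ≢-not (crosses uv) })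
        (𝟙-mono (On? (not s) v) (On? s u) λ v≡¬s → trans (≢-not (crosses uv ∘ sym)) (trans (cong not v≡¬s) (Bool.not-involutive s))))
    split : ∀ s → sum (deg G) ≡ sumOver (On? s) (deg G) + sumOver (On? s) (deg G)
    split s = trans (sum-cong-≗ λ v → once s (side v) (deg G v)) (trans (∑-distrib-+ (λ v → 𝟙 (On? s v) * deg G v) (λ v → 𝟙 (On? (not s) v) * deg G v))
                      (cong (sumOver (On? s) (deg G) +_) (sym (swap s))))
      where
      once : ∀ s t x → x ≡ 𝟙 (t Bool.≟ s) * x + 𝟙 (t Bool.≟ not s) * x
      once true  true  x = sym (trans (+-identityʳ _) (+-identityʳ _))
      once true  false x = sym (+-identityʳ _)
      once false true  x = sym (+-identityʳ _)
      once false false x = sym (trans (+-identityʳ _) (+-identityʳ _))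

  Missing : Vertex G → Vertex G → Set
  Missing u v = side u ≢ side v × ¬ Adj G u v

  Missing? : ∀ u → Decidable (Missing u)
  Missing? u v = ¬? (side u Bool.≟ side v) ×-dec ¬? (Adj? G u v)

  Full : Vertex G → Set
  Full u = ¬ ∃ (Missing u)

  Full? : Decidable Full
  Full? u = ¬? (any? (Missing? u))

  missing-sym : ∀ {u v} → Missing u v → Missing v u
  missing-sym (u≢v , ¬uv) = u≢v ∘ sym , ¬uv ∘ Adj-sym G

  adjacent : ∀ {u v} → side u ≢ side v → ¬ Missing u v → Adj G u v
  adjacent {u} {v} u≢v ¬m = decidable-stable (Adj? G u v) λ ¬uv → ¬m (u≢v , ¬uv)

  full-adjacent : ∀ {u v} → Full u → side u ≢ side v → Adj G u v
  full-adjacent full u≢v = adjacent u≢v λ m → full (_ , m)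

  deg+missing : ∀ {s} u → side u ≡ s → part (not s) ≡ deg G u + # (Missing? u)
  deg+missing {s} u refl = trans
    (≤-antisym (#-mono (On? (not s)) opp? not-≢) (#-mono opp? (On? (not s)) ≢-not))
    (trans (#-split opp? (Adj? G u)) (cong (_+ # (Missing? u))
      (≤-antisym (#-mono (λ v → opp? v ×-dec Adj? G u v) (Adj? G u) proj₂)
                 (#-mono (Adj? G u) (λ v → opp? v ×-dec Adj? G u v) λ uv → crosses uv , uv))))
    where
    opp? : Decidable (λ v → side u ≢ side v)
    opp? v = ¬? (side u Bool.≟ side v)

  deg≤part : ∀ {s u} → side u ≡ s → deg G u ≤ part (not s)
  deg≤part {u = u} e = ≤-trans (m≤m+n _ _) (≤-reflexive (sym (deg+missing u e)))

  deg≡part⇒full : ∀ {s u} → side u ≡ s → deg G u ≡ part (not s) → Full u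
  deg≡part⇒full {u = u} e d (w , m) = contradiction (+-cancelˡ-≤ (deg G u) _ _ (begin
    deg G u + 1                ≤⟨ +-monoʳ-≤ (deg G u) (#-∈ (Missing? u) m) ⟩
    deg G u + # (Missing? u)   ≡⟨ deg+missing u e ⟨
    part _                     ≡⟨ d ⟨
    deg G u                    ≡⟨ +-identityʳ _ ⟨
    deg G u + 0                ∎)) λ ()
    where open ≤-Reasoning

  -- Only a full vertex attains the degree `part (not s)`; this is e ≤ a b - a + 1 written without
  -- subtraction.
  few-full : ∀ s → (∀ {u v} → side u ≡ s → side v ≡ s → Full u → Full v → u ≡ v) →
             size G + part s ≤ part s * part (not s) + 1
  few-full s unique = ≤-trans (≤-reflexive (cong (_+ part s) (sym (side-degrees s))))
    (sumOver-≤ (On? s) (deg G) (part (not s)) deg≤part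
      λ p q e e′ → unique p q (deg≡part⇒full p e) (deg≡part⇒full q e′))

-- The missing cross edges form a matching. The apex is the one vertex of side `true` outside it;
-- side `false` has one such vertex or none, and this decides the parity of the order.
record Crown (G : Graph) : Set where
  field
    side           : Vertex G → Bool
    crosses        : ∀ {u v} → Adj G u v → side u ≢ side v
  open Bipartite G side crosses public
  field
    missing-unique : ∀ {u v w} → Missing u v → Missing u w → v ≡ w
    full-unique    : ∀ {u v} → side u ≡ side v → Full u → Full v → u ≡ v
    apex           : Vertex G
    apex-side      : side apex ≡ true
    apex-full      : Full apex

module _ {G : Graph} (crown : Crown G) where

  open Crown crown

  private
    N = order G
    e = size G
    a = part true
    b = part false

    part≤suc-deg : ∀ {s} u → side u ≡ s → part (not s) ≤ suc (deg G u)
    part≤suc-deg u p = ≤-trans (≤-reflexive (deg+missing u p))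
      (≤-trans (+-monoʳ-≤ (deg G u) (#-unique (Missing? u) missing-unique)) (≤-reflexive (+-comm (deg G u) 1)))

    each-misses-≤1 : ∀ s → part s * part (not s) ≤ e + part s
    each-misses-≤1 s = begin
      part s * part (not s)                              ≡⟨ *-distribʳ-sum (part (not s)) (λ v → 𝟙 (On? s v)) ⟩
      sum (λ v → 𝟙 (On? s v) * part (not s))             ≤⟨ sum-mono pointwise ⟩
      sum (λ v → 𝟙 (On? s v) * deg G v + 𝟙 (On? s v))    ≡⟨ ∑-distrib-+ (λ v → 𝟙 (On? s v) * deg G v) _ ⟩
      sumOver (On? s) (deg G) + part s                   ≡⟨ cong (_+ part s) (side-degrees s) ⟩
      e + part s                                         ∎
      where
      open ≤-Reasoning
      pointwise : ∀ v → 𝟙 (On? s v) * part (not s) ≤ 𝟙 (On? s v) * deg G v + 𝟙 (On? s v)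
      pointwise v with On? s v
      ... | no _  = z≤n
      ... | yes p = ≤-trans (≤-reflexive (+-identityʳ _)) (≤-trans (part≤suc-deg v p)
                      (≤-reflexive (trans (+-comm 1 _) (cong (_+ 1) (sym (+-identityʳ _))))))

    full-side-bound : ∀ s → e + part s ≤ part s * part (not s) + 1
    full-side-bound s = few-full s λ p q → full-unique (trans p (sym q))

    -- On its side the apex has degree b and every other vertex has degree b - 1.
    apex-side-size : e + a ≡ a * b + 1
    apex-side-size = ≤-antisym (full-side-bound true) (begin
      a * b + 1                                                  ≡⟨ cong₂ _+_ (*-distribʳ-sum b (λ v → 𝟙 (On? true v))) (sym (#-singleton apex)) ⟩
      sum (λ v → 𝟙 (On? true v) * b) + # (_≟ apex)               ≡⟨ ∑-distrib-+ (λ v → 𝟙 (On? true v) * b) (λ v → 𝟙 (v ≟ apex)) ⟨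
      sum (λ v → 𝟙 (On? true v) * b + 𝟙 (v ≟ apex))              ≤⟨ sum-mono pointwise ⟩
      sum (λ v → 𝟙 (On? true v) * deg G v + 𝟙 (On? true v))      ≡⟨ ∑-distrib-+ (λ v → 𝟙 (On? true v) * deg G v) _ ⟩
      sumOver (On? true) (deg G) + a                             ≡⟨ cong (_+ a) (side-degrees true) ⟩
      e + a                                                      ∎)
      where
      open ≤-Reasoning
      apex-deg : b ≤ deg G apex
      apex-deg = ≤-trans (≤-reflexive (deg+missing apex apex-side))
        (≤-reflexive (trans (cong (deg G apex +_) (#-none (Missing? apex) λ w m → apex-full (w , m))) (+-identityʳ _)))
      pointwise : ∀ v → 𝟙 (On? true v) * b + 𝟙 (v ≟ apex) ≤ 𝟙 (On? true v) * deg G v + 𝟙 (On? true v)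
      pointwise v with On? true v | v ≟ apex
      ... | yes _ | yes refl = +-monoˡ-≤ 1 (+-monoˡ-≤ 0 apex-deg)
      ... | no ¬p | yes refl = contradiction apex-side ¬p
      ... | no _  | no _     = z≤n
      ... | yes p | no _     = ≤-trans (≤-reflexive (trans (+-identityʳ _) (+-identityʳ _))) (≤-trans (part≤suc-deg v p)
                      (≤-reflexive (trans (+-comm 1 _) (cong (_+ 1) (sym (+-identityʳ _))))))

    -- Counting from the other side, which has at most one full vertex, gives e + b ≤ a b + 1 = e +
    -- a.
    b≤a : b ≤ a
    b≤a = +-cancelˡ-≤ e _ _ (≤-trans (full-side-bound false)
      (≤-reflexive (trans (cong (_+ 1) (*-comm b a)) (sym apex-side-size))))

    -- Each vertex of the other side misses at most one vertex, so a b ≤ e + b, whereas e + a = a b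
    -- + 1.
    a≤1+b : a ≤ suc b
    a≤1+b = +-cancelˡ-≤ e _ _ (begin
      e + a        ≡⟨ apex-side-size ⟩
      a * b + 1    ≡⟨ cong (_+ 1) (*-comm a b) ⟩
      b * a + 1    ≤⟨ +-monoˡ-≤ 1 (each-misses-≤1 false) ⟩
      e + b + 1    ≡⟨ trans (+-assoc e b 1) (cong (e +_) (+-comm b 1)) ⟩
      e + suc b    ∎)
      where open ≤-Reasoning

  -- Sides c + 1 and c + 1 give e = c² + c + 1, and (n - 1)² + 3 = 4e. Sides b + 1 and b give e = b²
  -- = (n - 1)²/4, where the ceiling has no effect.
  crown-size : 2 ≤ order G → size G ≡ ⌈ (order G ∸ 1) ^ 2 / 4 ⌉
  crown-size 2≤N = by-parity a b e (≤-trans 2≤N (≤-reflexive (sym parts))) b≤a a≤1+b apex-side-size parts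
    where
    by-parity : ∀ a b e → 2 ≤ a + b → b ≤ a → a ≤ suc b → e + a ≡ a * b + 1 → a + b ≡ N → e ≡ ⌈ (N ∸ 1) ^ 2 / 4 ⌉
    by-parity a b e 2≤a+b b≤a a≤1+b size refl with m≤n⇒m<n∨m≡n b≤a
    by-parity zero zero e () _ _ _ _ | inj₂ refl
    by-parity (suc c) (suc c) e _ _ _ size refl | inj₂ refl = begin
      e                                        ≡⟨ +-cancelʳ-≡ (suc c) e _ (trans size (lhs c)) ⟩
      c * c + c + 1                            ≡⟨ m*n/n≡m (c * c + c + 1) 4 ⟨
      ((c * c + c + 1) * 4) / 4                ≡⟨ cong (_/ 4) (rhs c) ⟨
      ((c + suc c) ^ 2 + 3) / 4                ∎
      where
      open ≡-Reasoning
      lhs : ∀ c → suc c * suc c + 1 ≡ c * c + c + 1 + suc c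
      lhs = solve-∀
      rhs : ∀ c → (c + suc c) * ((c + suc c) * 1) + 3 ≡ (c * c + c + 1) * 4
      rhs = solve-∀
    ... | inj₁ b<a with ≤-antisym b<a a≤1+b
    ...   | refl = begin
      e                                        ≡⟨ +-cancelʳ-≡ (suc b) e _ (trans size (lhs b)) ⟩
      b * b                                    ≡⟨ m*n/n≡m (b * b) 4 ⟨
      (b * b * 4) / 4                          ≡⟨ +-distrib-/-∣ʳ 3 (n∣m*n (b * b) {4}) ⟨
      (3 + b * b * 4) / 4                      ≡⟨ cong (_/ 4) (rhs b) ⟨
      ((b + b) ^ 2 + 3) / 4                    ∎
      where
      open ≡-Reasoning
      lhs : ∀ b → suc b * b + 1 ≡ b * b + suc b
      lhs = solve-∀
      rhs : ∀ b → (b + b) * ((b + b) * 1) + 3 ≡ 3 + b * b * 4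
      rhs = solve-∀

  parts≥3 : 6 ≤ order G → ∀ s → 3 ≤ part s
  parts≥3 6≤N = λ { true → ≤-trans 3≤b b≤a ; false → 3≤b }
    where
    3≤b : 3 ≤ b
    3≤b = ≮⇒≥ λ b<3 → <⇒≱ (begin-strict
      N              ≡⟨ parts ⟨
      a + b          ≤⟨ +-mono-≤ a≤1+b ≤-refl ⟩
      suc b + b      ≤⟨ +-mono-≤ b<3 (≤-pred b<3) ⟩
      3 + 2          <⟨ ≤-refl ⟩
      6              ∎) 6≤N
      where open ≤-Reasoning

-- The mp-number of a crown

three-members : {A : Set} {x y z : A} {xs : List A} → x ≢ y → x ≢ z → y ≢ z →
                x List.∈ xs → y List.∈ xs → z List.∈ xs → 3 ≤ length xs
three-members {xs = _ ∷ _ ∷ _ ∷ _} _ _ _ _ _ _ = s≤s (s≤s (s≤s z≤n))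
three-members x≢y _ _ (here refl) (here refl) _ = contradiction refl x≢y
three-members _ x≢z _ (here refl) _ (here refl) = contradiction refl x≢z
three-members _ _ y≢z _ (here refl) (here refl) = contradiction refl y≢z
three-members {xs = _ ∷ _ ∷ []} x≢y _ _ (there (here refl)) (there (here refl)) _ = contradiction refl x≢y
three-members {xs = _ ∷ _ ∷ []} _ x≢z _ (there (here refl)) _ (there (here refl)) = contradiction refl x≢z
three-members {xs = _ ∷ _ ∷ []} _ _ y≢z _ (there (here refl)) (there (here refl)) = contradiction refl y≢z

∣∣≡# : ∀ {n} (S : Subset n) → ∣ S ∣ ≡ # (_∈? S)
∣∣≡# []       = refl
∣∣≡# (s ∷ S) = head s
  where
  shift : ∀ i → 𝟙 (i ∈? S) ≡ 𝟙 (suc i ∈? (s ∷ S))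
  shift i = ≤-antisym (𝟙-mono (i ∈? S) (suc i ∈? (s ∷ S)) there) (𝟙-mono (suc i ∈? (s ∷ S)) (i ∈? S) drop-there)
  head : ∀ t → ∣ t ∷ S ∣ ≡ 𝟙 (zero ∈? (t ∷ S)) + sum (λ i → 𝟙 (suc i ∈? (s ∷ S)))
  head inside  = cong suc (trans (∣∣≡# S) (sum-cong-≗ shift))
  head outside = trans (∣∣≡# S) (sum-cong-≗ shift)

two-element-subset : ∀ {n} → 2 ≤ n → ∃ λ (S : Subset n) → ∣ S ∣ ≡ 2 × ∃ λ x → ∃ λ y → ∀ {v} → v ∈ S → v ≡ x ⊎ v ≡ y
two-element-subset {suc zero} (s≤s ())
two-element-subset {suc (suc n)} _ =
  inside ∷ inside ∷ ∅ , cong (2 +_) (∣⊥∣≡0 n) , zero , suc zero ,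
  λ { here → inj₁ refl ; (there here) → inj₂ refl ; (there (there v∈∅)) → contradiction v∈∅ ∉⊥ }

module _ (G : Graph) where

  cons-monophonic : ∀ {x y p} → Adj G x y → All (λ v → ¬ Adj G x v) p → All (x ≢_) p →
                    IsMonophonicPath G (y ∷ p) → IsMonophonicPath G (x ∷ y ∷ p)
  cons-monophonic {x} {y} {p} xy x≁p x∉p ((unique , linked) , chordless) =
    (((λ { refl → Adj-irrefl G xy }) ∷ x∉p) ∷ unique , xy ∷ linked) , λ
    { zero          zero          xx → contradiction xx (Adj-irrefl G)
    ; zero          (suc zero)    _  → refl
    ; (suc zero)    zero          _  → refl
    ; zero          (suc (suc j)) xv → contradiction xv (All.lookup x≁p (∈-lookup j))
    ; (suc (suc i)) zero          vx → contradiction (Adj-sym G vx) (All.lookup x≁p (∈-lookup i))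
    ; (suc i)       (suc j)       uv → chordless i j uv }

  singleton-monophonic : ∀ x → IsMonophonicPath G (x ∷ [])
  singleton-monophonic x = ([] ∷ [] , [-]) , λ { zero zero xx → contradiction xx (Adj-irrefl G) }

  HasPathThrough : Vertex G → Vertex G → Vertex G → Set
  HasPathThrough x y z = ∃ λ p → IsMonophonicPath G p × x List.∈ p × y List.∈ p × z List.∈ p

  -- Any pair is in monophonic position because a path repeats no vertex. A larger set contains
  -- three vertices, and the path through them refutes it.
  mp-number-2 : 2 ≤ order G → (∀ {x y z} → x ≢ y → x ≢ z → y ≢ z → HasPathThrough x y z) → HasMpNumber G 2
  mp-number-2 2≤N through = lower , upper
    where
    lower : ∃ λ S → InMonophonicPosition G S × ∣ S ∣ ≡ 2
    lower with two-element-subset 2≤N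
    ... | S , ∣S∣≡2 , x , y , among = S , position , ∣S∣≡2
      where
      position : InMonophonicPosition G S
      position p ((unique , _) , _) = two-values (filter⁺ (_∈? S) unique)
        λ v∈ → among (proj₂ (∈-filter⁻ (_∈? S) {xs = p} v∈))
    upper : ∀ S → InMonophonicPosition G S → ∣ S ∣ ≤ 2
    upper S position = ≮⇒≥ λ 3≤∣S∣ → let 3≤# = ≤-trans 3≤∣S∣ (≤-reflexive (∣∣≡# S)) in
      impossible 3≤# (#-witness (_∈? S) (≤-trans (s≤s z≤n) 3≤#))
      where
      impossible : 3 ≤ # (_∈? S) → ∃ (_∈ S) → ⊥
      impossible 3≤# (x , x∈S) with #-another (_∈? S) x (≤-trans (s≤s (s≤s z≤n)) 3≤#)
      ... | y , y∈S , y≢x with #-third (_∈? S) x y 3≤#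
      ...   | z , z∈S , z≢x , z≢y with through (y≢x ∘ sym) (z≢x ∘ sym) (z≢y ∘ sym)
      ...     | p , mono , x∈p , y∈p , z∈p = <⇒≱ (three-members (y≢x ∘ sym) (z≢x ∘ sym) (z≢y ∘ sym)
        (∈-filter⁺ (_∈? S) x∈p x∈S) (∈-filter⁺ (_∈? S) y∈p y∈S) (∈-filter⁺ (_∈? S) z∈p z∈S)) (position p mono)

module _ {G : Graph} (crown : Crown G) (6≤N : 6 ≤ order G) where

  open Crown crown

  private
    non-adjacent : ∀ {u v} → side u ≡ side v → ¬ Adj G u v
    non-adjacent e uv = crosses uv e

    ≢-side : ∀ {u v} → side u ≢ side v → u ≢ v
    ≢-side s refl = s refl

    same : ∀ {u v w} → side u ≢ side w → side v ≢ side w → side u ≡ side v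
    same p q = trans (≢-not (p ∘ sym)) (sym (≢-not (q ∘ sym)))

    adjacent-to-partner : ∀ {u v w} → Missing u v → w ≢ u → side w ≢ side v → Adj G w v
    adjacent-to-partner m w≢u w≢v = adjacent w≢v λ m′ → w≢u (missing-unique (missing-sym m′) (missing-sym m))

    path₃ : ∀ {x y z} → Adj G x y → Adj G y z → side x ≡ side z → x ≢ z → IsMonophonicPath G (x ∷ y ∷ z ∷ [])
    path₃ xy yz xz x≢z = cons-monophonic G xy (non-adjacent xz ∷ []) (x≢z ∷ [])
      (cons-monophonic G yz [] [] (singleton-monophonic G _))

    path₄ : ∀ {w x y z} → Adj G w x → Adj G x y → Adj G y z → Missing w z → w ≢ y → x ≢ z → IsMonophonicPath G (w ∷ x ∷ y ∷ z ∷ [])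
    path₄ wx xy yz (w≢z , w≁z) w≢y x≢z = cons-monophonic G wx
      (non-adjacent (same (crosses wx) (crosses (Adj-sym G xy))) ∷ w≁z ∷ []) (w≢y ∷ ≢-side w≢z ∷ [])
      (path₃ xy yz (same (crosses xy) (crosses (Adj-sym G yz))) x≢z)

    -- The path is x, v, z, u, y. Its only non-consecutive cross pairs are x, u and v, y, the two
    -- missing edges; the consecutive pairs are adjacent because `u` and `v` miss nothing else.
    through-two-matched : ∀ {x y z u v} → x ≢ y → x ≢ z → y ≢ z → side x ≡ side y → side x ≡ side z →
                          Missing x u → Missing y v → HasPathThrough G x z y
    through-two-matched {x} {y} {z} {u} {v} x≢y x≢z y≢z xy xz x∤u y∤v =
      x ∷ v ∷ z ∷ u ∷ y ∷ [] ,
      cons-monophonic G (adjacent-to-partner y∤v x≢y x≢v)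
        (non-adjacent xz ∷ proj₂ x∤u ∷ non-adjacent xy ∷ [])
        (x≢z ∷ ≢-side x≢u ∷ x≢y ∷ [])
        (path₄ (Adj-sym G (adjacent-to-partner y∤v (y≢z ∘ sym) (subst (_≢ side v) xz x≢v)))
          (adjacent-to-partner x∤u (x≢z ∘ sym) (subst (_≢ side u) xz x≢u))
          (Adj-sym G (adjacent-to-partner x∤u (x≢y ∘ sym) (subst (_≢ side u) xy x≢u)))
          (missing-sym y∤v) (λ { refl → x≢y (missing-unique (missing-sym x∤u) (missing-sym y∤v)) }) (y≢z ∘ sym)) ,
      here refl , there (there (here refl)) , there (there (there (there (here refl))))
      where
      x≢u = proj₁ x∤u
      x≢v : side x ≢ side v
      x≢v = subst (_≢ side v) (sym xy) (proj₁ y∤v)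

    -- At most one of three vertices on one side is full, so two of them have missing partners.
    through-one-side : ∀ {x y z} → x ≢ y → x ≢ z → y ≢ z → side x ≡ side y → side x ≡ side z → HasPathThrough G x y z
    through-one-side {x} {y} {z} x≢y x≢z y≢z xy xz with any? (Missing? x) | any? (Missing? y) | any? (Missing? z)
    ... | no fx       | no fy       | _           = contradiction (full-unique xy fx fy) x≢y
    ... | no fx       | _           | no fz       = contradiction (full-unique xz fx fz) x≢z
    ... | _           | no fy       | no fz       = contradiction (full-unique (trans (sym xy) xz) fy fz) y≢z
    ... | yes (_ , m) | yes (_ , k) | _           with through-two-matched x≢y x≢z y≢z xy xz m k
    ...   | p , mono , x∈ , z∈ , y∈ = p , mono , x∈ , y∈ , z∈
    through-one-side x≢y x≢z y≢z xy xz | yes (_ , m) | no _ | yes (_ , k) =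
      through-two-matched x≢z x≢y (y≢z ∘ sym) xz xy m k
    through-one-side x≢y x≢z y≢z xy xz | no _ | yes (_ , m) | yes (_ , k)
      with through-two-matched y≢z (x≢y ∘ sym) (x≢z ∘ sym) (trans (sym xy) xz) (sym xy) m k
    ... | p , mono , y∈ , x∈ , z∈ = p , mono , x∈ , y∈ , z∈

    -- The path is x, w, y, z, with ends not adjacent. The vertex `w` must lie on the side of `z`
    -- and avoid `z` and the missing partner of `y`; a side of three vertices leaves such a choice.
    through-missing : ∀ {x y z} → x ≢ y → side x ≡ side y → Missing x z → HasPathThrough G x y z
    through-missing {x} {y} {z} x≢y xy x∤z = extend (#-third (On? (side z)) z partner (parts≥3 crown 6≤N (side z)))
      where
      partner : Vertex G
      partner with any? (Missing? y)
      ... | yes (w , _) = w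
      -- A default for full `y`: the vertex `z` is excluded in any case.
      ... | no _        = z
      ≢partner : ∀ {w} → w ≢ partner → ¬ Missing y w
      ≢partner w≢ m with any? (Missing? y)
      ... | yes (_ , k) = w≢ (missing-unique m k)
      ... | no none     = none (_ , m)
      yz : side y ≢ side z
      yz = subst (_≢ side z) xy (proj₁ x∤z)
      extend : (∃ λ w → side w ≡ side z × w ≢ z × w ≢ partner) → HasPathThrough G x y z
      extend (w , wz , w≢z , w≢partner) =
        x ∷ w ∷ y ∷ z ∷ [] ,
        path₄ (adjacent (subst (side x ≢_) (sym wz) (proj₁ x∤z)) (λ m → w≢z (missing-unique m x∤z)))
          (Adj-sym G (adjacent (subst (side y ≢_) (sym wz) yz) (≢partner w≢partner)))
          (adjacent yz λ y∤z → x≢y (missing-unique (missing-sym x∤z) (missing-sym y∤z)))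
          x∤z x≢y w≢z ,
        here refl , there (there (here refl)) , there (there (there (here refl)))

    through-two-sides : ∀ {x y z} → x ≢ y → side x ≡ side y → side x ≢ side z → HasPathThrough G x y z
    through-two-sides {x} {y} {z} x≢y xy xz with Missing? x z | Missing? y z
    ... | yes m | _     = through-missing x≢y xy m
    ... | no _  | yes m with through-missing (x≢y ∘ sym) (sym xy) m
    ...   | p , mono , y∈ , x∈ , z∈ = p , mono , x∈ , y∈ , z∈
    through-two-sides {x} {y} {z} x≢y xy xz | no ¬m | no ¬k =
      x ∷ z ∷ y ∷ [] ,
      path₃ (adjacent xz ¬m) (Adj-sym G (adjacent (subst (_≢ side z) xy xz) ¬k)) xy x≢y ,
      here refl , there (there (here refl)) , there (here refl)

  crown-path : ∀ {x y z} → x ≢ y → x ≢ z → y ≢ z → HasPathThrough G x y z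
  crown-path {x} {y} {z} x≢y x≢z y≢z with side x Bool.≟ side y | side x Bool.≟ side z
  ... | yes xy | yes xz = through-one-side x≢y x≢z y≢z xy xz
  ... | yes xy | no xz  = through-two-sides x≢y xy xz
  ... | no xy  | yes xz with through-two-sides x≢z xz xy
  ...   | p , mono , x∈ , z∈ , y∈ = p , mono , x∈ , y∈ , z∈
  crown-path {x} {y} {z} x≢y x≢z y≢z | no xy | no xz
    with through-two-sides y≢z (same (xy ∘ sym) (xz ∘ sym)) (xy ∘ sym)
  ... | p , mono , y∈ , z∈ , x∈ = p , mono , x∈ , y∈ , z∈

  crown-mp-number : HasMpNumber G 2
  crown-mp-number = mp-number-2 G (≤-trans (s≤s (s≤s z≤n)) 6≤N) crown-path

-- Isomorphism of crowns

lookup-injective : {A : Set} {xs : List A} → Unique xs → ∀ {i j} → lookup xs i ≡ lookup xs j → i ≡ j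
lookup-injective (_ ∷ _)  {zero}  {zero}  _ = refl
lookup-injective (x∉ ∷ _) {zero}  {suc j} e = contradiction e (All.lookup x∉ (∈-lookup j))
lookup-injective (x∉ ∷ _) {suc i} {zero}  e = contradiction (sym e) (All.lookup x∉ (∈-lookup i))
lookup-injective (_ ∷ u)  {suc i} {suc j} e = cong suc (lookup-injective u e)

record Enumeration {n : ℕ} (P : Pred (Fin n) 0ℓ) : Set where
  field
    count     : ℕ
    element   : Fin count → Fin n
    injective : ∀ {i j} → element i ≡ element j → i ≡ j
    sound     : ∀ i → P (element i)
    complete  : ∀ {v} → P v → ∃ λ i → element i ≡ v

enumerate : ∀ {n} {P : Pred (Fin n) 0ℓ} → Decidable P → Enumeration P
enumerate {n} P? = record
  { count     = length xs
  ; element   = lookup xs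
  ; injective = lookup-injective (filter⁺ P? (allFin⁺ n))
  ; sound     = λ i → proj₂ (∈-filter⁻ P? {xs = allFin n} (∈-lookup {xs = xs} i))
  ; complete  = λ {v} p → let v∈xs = ∈-filter⁺ P? (∈-allFin v) p in Any.index v∈xs , sym (Any.lookup-index v∈xs)
  }
  where
  xs = filter P? (allFin n)

count≤1 : ∀ {n} {P : Pred (Fin n) 0ℓ} (E : Enumeration P) → (∀ {u v} → P u → P v → u ≡ v) → Enumeration.count E ≤ 1
count≤1 record { count = 0 } _ = z≤n
count≤1 record { count = 1 } _ = s≤s z≤n
count≤1 record { count = suc (suc _) ; injective = injective ; sound = sound } unique
  with injective (unique (sound zero) (sound (suc zero)))
... | ()

-- Coordinates on a crown: m matched pairs, the apex, and r full vertices on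
-- the other side.
Code : ℕ → ℕ → Set
Code m r = (Fin m ⊎ Fin 1) ⊎ (Fin m ⊎ Fin r)

Joined : ∀ {m r} → Fin m ⊎ Fin 1 → Fin m ⊎ Fin r → Set
Joined (inj₁ i) (inj₁ j) = i ≢ j
Joined (inj₁ _) (inj₂ _) = ⊤
Joined (inj₂ _) _        = ⊤

CodeAdj : ∀ {m r} → Code m r → Code m r → Set
CodeAdj (inj₁ x) (inj₂ y) = Joined x y
CodeAdj (inj₂ y) (inj₁ x) = Joined x y
CodeAdj (inj₁ _) (inj₁ _) = ⊥
CodeAdj (inj₂ _) (inj₂ _) = ⊥

record Coded (G : Graph) : Set where
  field
    m r       : ℕ
    r≤1       : r ≤ 1
    code      : Vertex G ↔ Code m r
    adjacency : ∀ u v → Adj G u v ⇔ CodeAdj (Inverse.to code u) (Inverse.to code v)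

-- Every vertex on the apex side other than the apex has a missing partner. Enumerating these
-- vertices thus also enumerates the matched vertices opposite; what remains there is full, hence at
-- most one vertex.
coded : ∀ {G} → Crown G → Coded G
coded {G} crown = record
  { m         = X.count
  ; r         = Y.count
  ; r≤1       = count≤1 full-sides λ (p , full) (q , full′) → full-unique (trans p (sym q)) full full′
  ; code      = mk↔ₛ′ encode decode (λ c → decode-injective _ c (decode-encode (decode c))) decode-encode
  ; adjacency = λ u v → mk⇔
      (λ uv → to-code (encode u) (encode v) (subst₂ (Adj G) (sym (decode-encode u)) (sym (decode-encode v)) uv))
      (λ j → subst₂ (Adj G) (decode-encode u) (decode-encode v) (from-code (encode u) (encode v) j))
  }
  where
  open Crown crown
  module X = Enumeration (enumerate (λ v → On? true v ×-dec ¬? (v ≟ apex)))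
  full-sides = enumerate (λ v → On? false v ×-dec Full? v)
  module Y = Enumeration full-sides

  partnered : ∀ i → ∃ (Missing (X.element i))
  partnered i with any? (Missing? (X.element i)) | X.sound i
  ... | yes found | _ = found
  ... | no full   | left , ≢apex = contradiction (full-unique (trans left (sym apex-side)) full apex-full) ≢apex

  partner : Fin X.count → Vertex G
  partner i = proj₁ (partnered i)

  partner-side : ∀ i → side (partner i) ≡ false
  partner-side i = trans (≢-not (proj₁ (proj₂ (partnered i)))) (cong not (proj₁ (X.sound i)))

  partner-injective : ∀ {i j} → partner i ≡ partner j → i ≡ j
  partner-injective {i} {j} e = X.injective (missing-unique (missing-sym (proj₂ (partnered i)))
    (subst (λ w → Missing w _) (sym e) (missing-sym (proj₂ (partnered j)))))

  decode : Code X.count Y.count → Vertex G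
  decode (inj₁ (inj₁ i)) = X.element i
  decode (inj₁ (inj₂ _)) = apex
  decode (inj₂ (inj₁ i)) = partner i
  decode (inj₂ (inj₂ j)) = Y.element j

  left-side : ∀ x → side (decode (inj₁ x)) ≡ true
  left-side (inj₁ i) = proj₁ (X.sound i)
  left-side (inj₂ _) = apex-side

  right-side : ∀ y → side (decode (inj₂ y)) ≡ false
  right-side (inj₁ i) = partner-side i
  right-side (inj₂ j) = proj₁ (Y.sound j)

  opposite : ∀ x y → side (decode (inj₁ x)) ≢ side (decode (inj₂ y))
  opposite x y e with trans (sym (left-side x)) (trans e (right-side y))
  ... | ()

  decode-injective : ∀ c d → decode c ≡ decode d → c ≡ d
  decode-injective (inj₁ x) (inj₂ y) e = contradiction (cong side e) (opposite x y)
  decode-injective (inj₂ y) (inj₁ x) e = contradiction (cong side (sym e)) (opposite x y)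
  decode-injective (inj₁ (inj₁ i)) (inj₁ (inj₁ j)) e = cong (inj₁ ∘ inj₁) (X.injective e)
  decode-injective (inj₁ (inj₁ i)) (inj₁ (inj₂ _)) e = contradiction e (proj₂ (X.sound i))
  decode-injective (inj₁ (inj₂ _)) (inj₁ (inj₁ j)) e = contradiction (sym e) (proj₂ (X.sound j))
  decode-injective (inj₁ (inj₂ zero)) (inj₁ (inj₂ zero)) e = refl
  decode-injective (inj₂ (inj₁ i)) (inj₂ (inj₁ j)) e = cong (inj₂ ∘ inj₁) (partner-injective e)
  decode-injective (inj₂ (inj₁ i)) (inj₂ (inj₂ j)) e =
    contradiction (X.element i , subst (λ w → Missing w (X.element i)) e (missing-sym (proj₂ (partnered i)))) (proj₂ (Y.sound j))
  decode-injective (inj₂ (inj₂ j)) (inj₂ (inj₁ i)) e =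
    contradiction (X.element i , subst (λ w → Missing w (X.element i)) (sym e) (missing-sym (proj₂ (partnered i)))) (proj₂ (Y.sound j))
  decode-injective (inj₂ (inj₂ i)) (inj₂ (inj₂ j)) e = cong (inj₂ ∘ inj₂) (Y.injective e)

  encoding : ∀ v → ∃ λ c → decode c ≡ v
  encoding v with side v in sv
  ... | true with v ≟ apex
  ...   | yes refl = inj₁ (inj₂ zero) , refl
  ...   | no v≢apex with X.complete (sv , v≢apex)
  ...     | i , e = inj₁ (inj₁ i) , e
  encoding v | false with any? (Missing? v)
  ... | no full with Y.complete (sv , full)
  ...   | j , e = inj₂ (inj₂ j) , e
  -- The missing partner `w` is on the apex side and differs from the apex, which is full, so it has
  -- been enumerated.
  encoding v | false | yes (w , m) with X.complete {w} (trans (≢-not (proj₁ m)) (cong not sv) , λ { refl → apex-full (_ , missing-sym m) })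
  ...   | i , refl = inj₂ (inj₁ i) , missing-unique (proj₂ (partnered i)) (missing-sym m)

  encode : Vertex G → Code X.count Y.count
  encode v = proj₁ (encoding v)

  decode-encode : ∀ v → decode (encode v) ≡ v
  decode-encode v = proj₂ (encoding v)

  joined : ∀ x y → Joined x y → Adj G (decode (inj₁ x)) (decode (inj₂ y))
  joined (inj₁ i) (inj₁ j) i≢j = adjacent (opposite (inj₁ i) (inj₁ j))
    λ m → i≢j (partner-injective (missing-unique (proj₂ (partnered i)) m))
  joined (inj₁ i) (inj₂ j) _ = Adj-sym G (full-adjacent (proj₂ (Y.sound j)) (opposite (inj₁ i) (inj₂ j) ∘ sym))
  joined (inj₂ z) y        _ = full-adjacent apex-full (opposite (inj₂ z) y)

  unjoined : ∀ x y → Adj G (decode (inj₁ x)) (decode (inj₂ y)) → Joined x y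
  unjoined (inj₁ i) (inj₁ j) ij refl = proj₂ (proj₂ (partnered i)) ij
  unjoined (inj₁ _) (inj₂ _) _ = tt
  unjoined (inj₂ _) _        _ = tt

  from-code : ∀ c d → CodeAdj c d → Adj G (decode c) (decode d)
  from-code (inj₁ x) (inj₂ y) j = joined x y j
  from-code (inj₂ y) (inj₁ x) j = Adj-sym G (joined x y j)

  to-code : ∀ c d → Adj G (decode c) (decode d) → CodeAdj c d
  to-code (inj₁ x) (inj₂ y) uv = unjoined x y uv
  to-code (inj₂ y) (inj₁ x) uv = unjoined x y (Adj-sym G uv)
  to-code (inj₁ x) (inj₁ y) uv = crosses uv (trans (left-side x) (sym (left-side y)))
  to-code (inj₂ x) (inj₂ y) uv = crosses uv (trans (right-side x) (sym (right-side y)))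

code-size : ∀ {n m r} → Fin n ↔ Code m r → n ≡ (m + 1) + (m + r)
code-size code = ↔⇒≡ (↔-trans code (↔-trans (↔-sym Fin.+↔⊎ ⊎-↔ ↔-sym Fin.+↔⊎) (↔-sym Fin.+↔⊎)))

-- The order is 2m + 1 + r with r at most 1, so its parity determines r, and then m follows.
code-parameters : ∀ m m′ {r r′} → r ≤ 1 → r′ ≤ 1 → (m + 1) + (m + r) ≡ (m′ + 1) + (m′ + r′) → m ≡ m′ × r ≡ r′
code-parameters zero    zero     _   _    e = refl , suc-injective e
code-parameters zero    (suc m′) r≤1 _    e = contradiction e (too-many m′ r≤1)
  where
  too-many : ∀ m {r r′} → r′ ≤ 1 → 1 + r′ ≢ (suc m + 1) + (suc m + r)
  too-many m r′≤1 = <⇒≢ (≤-trans (s≤s (s≤s r′≤1)) (+-mono-≤ (s≤s (m≤n+m 1 m)) (s≤s z≤n)))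
code-parameters (suc m) zero     r≤1 r′≤1 e with code-parameters zero (suc m) r′≤1 r≤1 (sym e)
... | ()
code-parameters (suc m) (suc m′) {r} {r′} r≤1 r′≤1 e with code-parameters m m′ r≤1 r′≤1 (suc-injective
    (trans (sym (+-suc (m + 1) (m + r))) (trans (suc-injective e) (+-suc (m′ + 1) (m′ + r′)))))
... | refl , r≡r′ = refl , r≡r′

-- Adjacency of codes depends only on the parameters m and r, which the order fixes; so one coding
-- can be followed by the inverse of the other.
crowns-isomorphic : ∀ {G H} → Crown G → Crown H → order G ≡ order H → G ≅ H
crowns-isomorphic {G} {H} crown-G crown-H same-order = match (coded crown-G) (coded crown-H)
  where
  match : Coded G → Coded H → G ≅ H
  match cG cH with code-parameters (Coded.m cG) (Coded.m cH) (Coded.r≤1 cG) (Coded.r≤1 cH)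
                     (trans (sym (code-size (Coded.code cG))) (trans same-order (code-size (Coded.code cH))))
  match cG record { m = m ; r = r ; code = code ; adjacency = adjacency } | refl , refl = record
    { bijection = ↔-trans (Coded.code cG) (↔-sym code)
    ; adjacency = λ u v → mk⇔
        (λ uv → Equivalence.from (adjacency _ _) (subst₂ CodeAdj (sym (back (to-code u))) (sym (back (to-code v)))
                  (Equivalence.to (Coded.adjacency cG u v) uv)))
        (λ uv → Equivalence.from (Coded.adjacency cG u v) (subst₂ CodeAdj (back (to-code u)) (back (to-code v))
                  (Equivalence.to (adjacency _ _) uv)))
    }
    where
    to-code = Inverse.to (Coded.code cG)
    back : ∀ c → Inverse.to code (Inverse.from code c) ≡ c
    back c = Inverse.strictlyInverseˡ code c

-- The graphs T* and T*+

private variable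
  a b : ℕ

sideOf : Fin a ⊎ Fin b → Bool
sideOf (inj₁ _) = true
sideOf (inj₂ _) = false

opposite⇒≢ : ∀ {s t : Fin a ⊎ Fin b} → Opposite s t → sideOf s ≢ sideOf t
opposite⇒≢ {s = inj₁ _} {inj₂ _} _ ()
opposite⇒≢ {s = inj₂ _} {inj₁ _} _ ()

≢⇒opposite : ∀ {s t : Fin a ⊎ Fin b} → sideOf s ≢ sideOf t → Opposite s t
≢⇒opposite {s = inj₁ _} {inj₂ _} _ = tt
≢⇒opposite {s = inj₂ _} {inj₁ _} _ = tt
≢⇒opposite {s = inj₁ _} {inj₁ _} s≢t = s≢t refl
≢⇒opposite {s = inj₂ _} {inj₂ _} s≢t = s≢t refl

sameIndex⇒opposite : ∀ {s t : Fin a ⊎ Fin b} → SameIndex s t → Opposite s t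
sameIndex⇒opposite {s = inj₁ _} {inj₂ _} _ = tt
sameIndex⇒opposite {s = inj₂ _} {inj₁ _} _ = tt

sameIndex-functional : ∀ {s t t′ : Fin a ⊎ Fin b} → SameIndex s t → SameIndex s t′ → t ≡ t′
sameIndex-functional {s = inj₁ _} {inj₂ _} {inj₂ _} e e′ = cong inj₂ (Fin.toℕ-injective (trans (sym e) e′))
sameIndex-functional {s = inj₂ _} {inj₁ _} {inj₁ _} e e′ = cong inj₁ (Fin.toℕ-injective (trans e (sym e′)))

splitAt-injective : ∀ a {b} {u v : Fin (a + b)} → splitAt a u ≡ splitAt a v → u ≡ v
splitAt-injective a {b} {u} {v} e = trans (sym (Fin.join-splitAt a b u)) (trans (cong (join a b) e) (Fin.join-splitAt a b v))

matched-functional : ∀ a b (u v w : Fin (a + b)) → Matched {a} {b} u v → Matched {a} {b} u w → v ≡ w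
matched-functional a b u v w p q = splitAt-injective a
  (sameIndex-functional {s = splitAt a u} {splitAt a v} {splitAt a w} p q)

partner-of : ∀ a {b} (u : Fin (a + b)) → (∃ λ t → SameIndex (splitAt a u) t) → ∃ λ v → Matched {a} {b} u v
partner-of a {b} u (t , p) = join a b t , subst (SameIndex (splitAt a u)) (sym (Fin.splitAt-join a b t)) p

-- `T* n` unfolds to this graph at the two halves of `n`. With free block sizes, an equation between
-- the halves can be eliminated.
crownGraph : ℕ → ℕ → Graph
crownGraph a b = deleteEdges (completeBipartite a b) (Matched {a} {b}) (matched? {a} {b})
                   (λ {u} {v} → matched-sym {a} {b} {u} {v})

-- Index b occurs only in the larger block, so its vertex is the only one without a partner and
-- serves as the apex.
odd-crown : ∀ b → Crown (crownGraph (suc b) b)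
odd-crown b = record
  { side           = side
  ; crosses        = λ {u} {v} → crosses u v
  ; missing-unique = λ {u} {v} {w} m k → matched-functional (suc b) b u v w (missing⇒matched u v m) (missing⇒matched u w k)
  ; full-unique    = λ {u} {v} _ p q → splitAt-injective (suc b) (trans (full⇒last u p) (sym (full⇒last v q)))
  ; apex           = last
  ; apex-side      = cong sideOf splitAt-last
  ; apex-full      = λ (w , m) → last-unmatched (splitAt (suc b) w)
      (subst (λ s → SameIndex s (splitAt (suc b) w)) splitAt-last (missing⇒matched last w m))
  }
  where
  G = crownGraph (suc b) b
  side : Vertex G → Bool
  side u = sideOf (splitAt (suc b) u)
  crosses : ∀ u v → Adj G u v → side u ≢ side v
  crosses u v (o , _) = opposite⇒≢ {s = splitAt (suc b) u} {splitAt (suc b) v} o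
  open Bipartite G side (λ {u} {v} → crosses u v) using (Missing; Full)
  last : Vertex G
  last = join (suc b) b (inj₁ (fromℕ b))
  splitAt-last : splitAt (suc b) last ≡ inj₁ (fromℕ b)
  splitAt-last = Fin.splitAt-join (suc b) b (inj₁ (fromℕ b))
  missing⇒matched : ∀ u v → Missing u v → Matched {suc b} {b} u v
  missing⇒matched u v (u≢v , ¬uv) = decidable-stable (matched? {suc b} {b} u v)
    λ ¬m → ¬uv (≢⇒opposite {s = splitAt (suc b) u} {splitAt (suc b) v} u≢v , ¬m)
  matched⇒missing : ∀ u v → Matched {suc b} {b} u v → Missing u v
  matched⇒missing u v m =
    opposite⇒≢ {s = splitAt (suc b) u} {splitAt (suc b) v} (sameIndex⇒opposite {s = splitAt (suc b) u} {splitAt (suc b) v} m) ,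
    λ (_ , ¬m) → ¬m m
  last-unmatched : ∀ (t : Fin (suc b) ⊎ Fin b) → ¬ SameIndex (inj₁ (fromℕ b)) t
  last-unmatched (inj₂ j) e = <-irrefl (trans (sym e) (Fin.toℕ-fromℕ b)) (Fin.toℕ<n j)
  matched-or-last : ∀ (s : Fin (suc b) ⊎ Fin b) → (∃ λ t → SameIndex s t) ⊎ s ≡ inj₁ (fromℕ b)
  matched-or-last (inj₂ j) = inj₁ (inj₁ (inject₁ j) , Fin.toℕ-inject₁ j)
  matched-or-last (inj₁ i) with b ℕ.≟ toℕ i
  ... | yes b≡i = inj₂ (cong inj₁ (Fin.toℕ-injective (trans (sym b≡i) (sym (Fin.toℕ-fromℕ b)))))
  ... | no b≢i  = inj₁ (inj₂ (lower₁ i b≢i) , sym (Fin.toℕ-lower₁ i b≢i))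
  full⇒last : ∀ u → Full u → splitAt (suc b) u ≡ inj₁ (fromℕ b)
  full⇒last u full = [ (λ found → contradiction (let v , m = partner-of (suc b) u found in v , matched⇒missing u v m) full) , id ]′
    (matched-or-last (splitAt (suc b) u))

-- The deleted matching is perfect, and a non-adjacent cross pair is one of its pairs. Restoring
-- that edge makes its two ends the only full vertices, one on each side.
even-crown : ∀ b {u v : Fin (b + b)} → Across {b} {b} u v → ¬ Adj (crownGraph b b) u v → (u≢v : u ≢ v) →
             Crown (addEdge (crownGraph b b) u v u≢v)
even-crown b {u} {v} u-v u≁v u≢v = record
  { side           = side
  ; crosses        = λ {x} {y} → crosses x y
  ; missing-unique = λ {x} {y} {z} m k → matched-functional b b x y z (missing⇒matched x y m) (missing⇒matched x z k)
  ; full-unique    = λ {x} {y} e p q → same e (full⇒end x p) (full⇒end y q)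
  ; apex           = proj₁ apex
  ; apex-side      = proj₁ (proj₂ apex)
  ; apex-full      = proj₂ (proj₂ apex)
  }
  where
  G = addEdge (crownGraph b b) u v u≢v
  side : Vertex G → Bool
  side x = sideOf (splitAt b x)
  across⇒≢ : ∀ x y → Across {b} {b} x y → side x ≢ side y
  across⇒≢ x y = opposite⇒≢ {s = splitAt b x} {splitAt b y}
  crosses : ∀ x y → Adj G x y → side x ≢ side y
  crosses x y (inj₁ (o , _))              = across⇒≢ x y o
  crosses _ _ (inj₂ (inj₁ (refl , refl))) = across⇒≢ u v u-v
  crosses _ _ (inj₂ (inj₂ (refl , refl))) = across⇒≢ u v u-v ∘ sym
  open Bipartite G side (λ {x} {y} → crosses x y) using (Missing; Full)
  u∥v : Matched {b} {b} u v
  u∥v = decidable-stable (matched? {b} {b} u v) λ ¬m → u≁v (u-v , ¬m)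
  missing⇒matched : ∀ x y → Missing x y → Matched {b} {b} x y
  missing⇒matched x y (x≢y , ¬xy) = decidable-stable (matched? {b} {b} x y)
    λ ¬m → ¬xy (inj₁ (≢⇒opposite {s = splitAt b x} {splitAt b y} x≢y , ¬m))
  partner : ∀ x → ∃ λ y → Matched {b} {b} x y
  partner x = partner-of b x (other (splitAt b x))
    where
    other : (s : Fin b ⊎ Fin b) → ∃ λ t → SameIndex s t
    other (inj₁ i) = inj₂ i , refl
    other (inj₂ i) = inj₁ i , refl
  full⇒end : ∀ x → Full x → x ≡ u ⊎ x ≡ v
  full⇒end x full with x ≟ u | x ≟ v | partner x
  ... | yes x≡u | _       | _     = inj₁ x≡u
  ... | no _    | yes x≡v | _     = inj₂ x≡v
  ... | no x≢u  | no x≢v  | y , m = contradiction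
    (y , across⇒≢ x y (sameIndex⇒opposite {s = splitAt b x} {splitAt b y} m) ,
     λ { (inj₁ (_ , ¬m)) → ¬m m ; (inj₂ (inj₁ (x≡u , _))) → x≢u x≡u ; (inj₂ (inj₂ (x≡v , _))) → x≢v x≡v })
    full
  same : ∀ {x y} → side x ≡ side y → x ≡ u ⊎ x ≡ v → y ≡ u ⊎ y ≡ v → x ≡ y
  same e (inj₁ refl) (inj₁ refl) = refl
  same e (inj₂ refl) (inj₂ refl) = refl
  same e (inj₁ refl) (inj₂ refl) = contradiction e (across⇒≢ u v u-v)
  same e (inj₂ refl) (inj₁ refl) = contradiction (sym e) (across⇒≢ u v u-v)
  u-full : Full u
  u-full (w , m) with matched-functional b b u w v (missing⇒matched u w m) u∥v
  ... | refl = proj₂ m (inj₂ (inj₁ (refl , refl)))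
  v-full : Full v
  v-full (w , m) with matched-functional b b v w u (missing⇒matched v w m) (matched-sym {b} {b} {u} {v} u∥v)
  ... | refl = proj₂ m (inj₂ (inj₂ (refl , refl)))
  apex : ∃ λ x → side x ≡ true × Full x
  apex with side u in e
  ... | true  = u , e , u-full
  ... | false = v , trans (≢-not (across⇒≢ u v u-v)) (cong not e) , v-full

⌈n/2⌉≤1+⌊n/2⌋ : ∀ n → ⌈ n /2⌉ ≤ suc ⌊ n /2⌋
⌈n/2⌉≤1+⌊n/2⌋ 0             = z≤n
⌈n/2⌉≤1+⌊n/2⌋ 1             = s≤s z≤n
⌈n/2⌉≤1+⌊n/2⌋ (suc (suc n)) = s≤s (⌈n/2⌉≤1+⌊n/2⌋ n)

order-T* : ∀ n → order (T* n) ≡ n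
order-T* n = trans (+-comm ⌈ n /2⌉ ⌊ n /2⌋) (⌊n/2⌋+⌈n/2⌉≡n n)

odd-halves : ∀ n → 2 ∤ n → ⌈ n /2⌉ ≡ suc ⌊ n /2⌋
odd-halves n 2∤n = ≤-antisym (⌈n/2⌉≤1+⌊n/2⌋ n) (≤∧≢⇒< (⌊n/2⌋≤⌈n/2⌉ n) λ e →
  2∤n (divides ⌊ n /2⌋ (trans (sym (⌊n/2⌋+⌈n/2⌉≡n n)) (trans (cong (⌊ n /2⌋ +_) (sym e)) (double ⌊ n /2⌋)))))
  where
  double : ∀ x → x + x ≡ x * 2
  double = solve-∀

even-halves : ∀ n → 2 ∣ n → ⌈ n /2⌉ ≡ ⌊ n /2⌋
even-halves n (divides q refl) = trans (even q) (sym (even′ q))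
  where
  even : ∀ q → ⌈ q * 2 /2⌉ ≡ q
  even zero    = refl
  even (suc q) = cong suc (even q)
  even′ : ∀ q → ⌊ q * 2 /2⌋ ≡ q
  even′ zero    = refl
  even′ (suc q) = cong suc (even′ q)

T*-crown : ∀ n → 2 ∤ n → Crown (T* n)
T*-crown n 2∤n = subst (λ a → Crown (crownGraph a ⌊ n /2⌋)) (sym (odd-halves n 2∤n)) (odd-crown ⌊ n /2⌋)

T*+-crown : ∀ n → 2 ∣ n → (e : CrossNonEdge n) → Crown (T*+ n e)
T*+-crown n 2∣n e = at-halves (even-halves n 2∣n) across nonAdj u≢v
  where
  open CrossNonEdge e
  at-halves : ∀ {a b} → a ≡ b → {u v : Fin (a + b)} → Across {a} {b} u v → ¬ Adj (crownGraph a b) u v →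
              (u≢v : u ≢ v) → Crown (addEdge (crownGraph a b) u v u≢v)
  at-halves {b = b} refl = even-crown b

crossNonEdge : ∀ n → 2 ≤ n → CrossNonEdge n
crossNonEdge (suc zero) (s≤s ())
crossNonEdge (suc (suc n)) _ = record
  { u = x ; v = y
  ; across = subst₂ Opposite (sym split-x) (sym split-y) tt
  ; nonAdj = λ (_ , ¬m) → ¬m (subst₂ SameIndex (sym split-x) (sym split-y) refl) }
  where
  a′ = suc ⌈ n /2⌉
  b′ = suc ⌊ n /2⌋
  x = join a′ b′ (inj₁ zero)
  y = join a′ b′ (inj₂ zero)
  split-x : splitAt a′ x ≡ inj₁ zero
  split-x = Fin.splitAt-join a′ b′ (inj₁ zero)
  split-y : splitAt a′ y ≡ inj₂ zero
  split-y = Fin.splitAt-join a′ b′ (inj₂ zero)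

-- Numerical estimates

sum-tight : ∀ {x y x′ y′} → x ≤ x′ → y ≤ y′ → x′ + y′ ≤ x + y → x′ ≤ x × y′ ≤ y
sum-tight {x} {y} {x′} {y′} x≤x′ y≤y′ tight =
  +-cancelʳ-≤ y′ x′ x (≤-trans tight (+-monoʳ-≤ x y≤y′)) , +-cancelˡ-≤ x′ y′ y (≤-trans tight (+-monoˡ-≤ y x≤x′))

quarter : ∀ {m e} → m ≤ 4 * e → (m + 3) / 4 ≤ e
quarter {m} {e} m≤4e = ≤-pred (m<n*o⇒m/o<n {m + 3} {suc e} {4} (begin-strict
  m + 3        <⟨ +-monoʳ-< m ≤-refl ⟩
  m + 4        ≤⟨ +-monoˡ-≤ 4 m≤4e ⟩
  4 * e + 4    ≡⟨ ring e ⟩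
  suc e * 4    ∎))
  where
  open ≤-Reasoning
  ring : ∀ e → 4 * e + 4 ≡ suc e * 4
  ring = solve-∀

4xy≤[x+y]² : ∀ x y → 4 * (x * y) ≤ (x + y) * (x + y)
4xy≤[x+y]² x y = begin
  4 * (x * y)                        ≡⟨ l x y ⟩
  2 * (x * y) + 2 * (x * y)          ≤⟨ +-monoʳ-≤ (2 * (x * y)) (2xy≤x²+y² x y) ⟩
  2 * (x * y) + (x * x + y * y)      ≡⟨ r x y ⟩
  (x + y) * (x + y)                  ∎
  where
  open ≤-Reasoning
  l : ∀ x y → 4 * (x * y) ≡ 2 * (x * y) + 2 * (x * y)
  l = solve-∀
  r : ∀ x y → 2 * (x * y) + (x * x + y * y) ≡ (x + y) * (x + y)
  r = solve-∀


-- The bounds on the sums of degrees over X \ N(z), X ∩ N(z), Y \ N(z) and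
-- Y ∩ N(z), where X = N(v) and Y = N(u), each increased by the size of the class, where these sizes are
-- p′, p, q′ and q.
module Bounds (p p′ q q′ : ℕ) where

  bound₁ bound₂ bound₃ bound₄ total : ℕ
  bound₁ = p′ * (q + q′) + 1
  bound₂ = p * (q′ + 1) + 1
  bound₃ = q′ * (p + p′) + 1
  bound₄ = q * (p′ + 1) + 1
  -- The summand p + q bounds the degree of z, whose neighbours lie in X ∩ N(z) and Y ∩ N(z).
  total  = ((bound₁ + bound₂) + (bound₃ + bound₄)) + (p + q)

module _ where
  open Bounds

  -- A finite check over class sizes 1 to 3, the range left by `order-7`. Here s stands for n - 1,
  -- and the size is replaced by its least admissible value ⌈s²/4⌉.
  small-cases : ∀ (p p′ q q′ : Fin 3) →
    let P = suc (toℕ p) ; P′ = suc (toℕ p′) ; Q = suc (toℕ q) ; Q′ = suc (toℕ q′) ; s = (P + P′) + (Q + Q′) in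
    5 ≤ s → 2 * ⌈ s * s / 4 ⌉ + s ≤ total P P′ Q Q′ →
    (P + P′ ≡ 3 × Q + Q′ ≡ 3 × (P ≡ 1 ⊎ Q ≡ 1)) × total P P′ Q Q′ ≤ 2 * ⌈ s * s / 4 ⌉ + s
  small-cases = from-yes (all? λ (p : Fin 3) → all? λ (p′ : Fin 3) → all? λ (q : Fin 3) → all? λ (q′ : Fin 3) →
    let P = suc (toℕ p) ; P′ = suc (toℕ p′) ; Q = suc (toℕ q) ; Q′ = suc (toℕ q′) ; s = (P + P′) + (Q + Q′) in
    (5 ≤? s) →-dec ((2 * ⌈ s * s / 4 ⌉ + s ≤? total P P′ Q Q′) →-dec
    ((P + P′ ℕ.≟ 3 ×-dec Q + Q′ ℕ.≟ 3 ×-dec (P ℕ.≟ 1 ⊎-dec Q ℕ.≟ 1)) ×-dec (total P P′ Q Q′ ≤? 2 * ⌈ s * s / 4 ⌉ + s))))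

  -- Doubling the edge count and comparing it with s² ≤ 4e yields 2s ≤ 12. All four classes are
  -- nonempty, so their sizes exceed 1 by at most 2 in all. The second conclusion says that the
  -- surviving configuration attains every bound.
  order-7 : ∀ {p p′ q q′ e} → 1 ≤ p → 1 ≤ p′ → 1 ≤ q → 1 ≤ q′ → let s = (p + p′) + (q + q′) in
    5 ≤ s → s * s ≤ 4 * e → 2 * e + s ≤ total p p′ q q′ →
    (p + p′ ≡ 3 × q + q′ ≡ 3 × (p ≡ 1 ⊎ q ≡ 1)) × total p p′ q q′ ≤ 2 * e + s
  order-7 {suc p} {suc p′} {suc q} {suc q′} {e} _ _ _ _ 5≤s dense few =
    finish (at (<3 p p≤) (<3 p′ p′≤) (<3 q q≤) (<3 q′ q′≤))
    where
    open ≤-Reasoning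
    s = (suc p + suc p′) + (suc q + suc q′)
    C = total (suc p) (suc p′) (suc q) (suc q′)
    2s≤12 : 2 * s ≤ 12
    2s≤12 = +-cancelˡ-≤ (s * s) _ _ (begin
      s * s + 2 * s                                            ≤⟨ +-monoˡ-≤ (2 * s) dense ⟩
      4 * e + 2 * s                                            ≡⟨ ring₁ e s ⟩
      2 * (2 * e + s)                                          ≤⟨ *-monoʳ-≤ 2 few ⟩
      -- The names p and q now stand for the class sizes less one. The term 4 p q completes twice
      -- the total to 4 (p + p′)(q + q′) + 12 in the original sizes.
      2 * C                                                    ≤⟨ m≤m+n (2 * C) (4 * (p * q)) ⟩
      2 * C + 4 * (p * q)                                      ≡⟨ ring₂ p p′ q q′ ⟩
      4 * ((suc p + suc p′) * (suc q + suc q′)) + 12           ≤⟨ +-monoˡ-≤ 12 (4xy≤[x+y]² (suc p + suc p′) (suc q + suc q′)) ⟩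
      s * s + 12                                               ∎)
      where
      ring₁ : ∀ e s → 4 * e + 2 * s ≡ 2 * (2 * e + s)
      ring₁ = solve-∀
      ring₂ : ∀ p p′ q q′ →
        2 * (((suc p′ * (suc q + suc q′) + 1 + (suc p * (suc q′ + 1) + 1)) +
              (suc q′ * (suc p + suc p′) + 1 + (suc q * (suc p′ + 1) + 1))) + (suc p + suc q)) + 4 * (p * q)
          ≡ 4 * ((suc p + suc p′) * (suc q + suc q′)) + 12
      ring₂ = solve-∀
    s≡ : s ≡ 4 + (p + (p′ + (q + q′)))
    s≡ = ring p p′ q q′
      where
      ring : ∀ p p′ q q′ → (suc p + suc p′) + (suc q + suc q′) ≡ 4 + (p + (p′ + (q + q′)))
      ring = solve-∀
    Σ≤2 : p + (p′ + (q + q′)) ≤ 2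
    Σ≤2 = +-cancelˡ-≤ 4 _ _ (≤-trans (≤-reflexive (sym s≡)) (*-cancelˡ-≤ 2 2s≤12))
    p≤ : p ≤ 2
    p≤ = m+n≤o⇒m≤o p Σ≤2
    rest₁ = m+n≤o⇒n≤o p Σ≤2
    p′≤ : p′ ≤ 2
    p′≤ = m+n≤o⇒m≤o p′ rest₁
    rest₂ = m+n≤o⇒n≤o p′ rest₁
    q≤ : q ≤ 2
    q≤ = m+n≤o⇒m≤o q rest₂
    q′≤ : q′ ≤ 2
    q′≤ = m+n≤o⇒n≤o q rest₂
    <3 : ∀ k → k ≤ 2 → ∃ λ (i : Fin 3) → toℕ i ≡ k
    <3 k k≤2 = fromℕ< (s≤s k≤2) , Fin.toℕ-fromℕ< (s≤s k≤2)
    2⌈⌉≤2e : 2 * ⌈ s * s / 4 ⌉ ≤ 2 * e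
    2⌈⌉≤2e = *-monoʳ-≤ 2 (quarter {s * s} {e} dense)
    Claim : ℕ → ℕ → ℕ → ℕ → Set
    Claim p p′ q q′ = (suc p + suc p′ ≡ 3 × suc q + suc q′ ≡ 3 × (suc p ≡ 1 ⊎ suc q ≡ 1)) ×
      total (suc p) (suc p′) (suc q) (suc q′) ≤
        2 * ⌈ ((suc p + suc p′) + (suc q + suc q′)) * ((suc p + suc p′) + (suc q + suc q′)) / 4 ⌉ + ((suc p + suc p′) + (suc q + suc q′))
    at : (∃ λ (i : Fin 3) → toℕ i ≡ p) → (∃ λ (i : Fin 3) → toℕ i ≡ p′) → (∃ λ (i : Fin 3) → toℕ i ≡ q) →
         (∃ λ (i : Fin 3) → toℕ i ≡ q′) → Claim p p′ q q′
    at (i , refl) (i′ , refl) (j , refl) (j′ , refl) = small-cases i i′ j j′ 5≤s (≤-trans (+-monoˡ-≤ s 2⌈⌉≤2e) few)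
    finish : Claim p p′ q q′ → _
    finish (shape , C≤) = shape , ≤-trans C≤ (+-monoˡ-≤ s 2⌈⌉≤2e)

-- With a − b = d the hypotheses give 4 a b + (d + 1)² ≤ 4 (e + a) ≤ 4 a b + 4.
dense-bipartite : ∀ {a b e} → b ≤ a → 6 ≤ a + b → (a + b ∸ 1) ^ 2 ≤ 4 * e → e + a ≤ a * b + 1 → 3 ≤ b × a * b + 1 ≤ e + a
dense-bipartite {a} {zero} {e} _ 6≤ _ few = contradiction
  (≤-trans (≤-trans 6≤ (≤-reflexive (+-identityʳ a))) (≤-trans (m≤n+m a e) (≤-trans few (≤-reflexive (cong (_+ 1) (*-zeroʳ a)))))) λ { (s≤s ()) }
dense-bipartite {a} {suc c} {e} b≤a 6≤ dense few with m≤n⇒∃[o]m+o≡n b≤a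
... | d , refl = 3≤b , ab<e+a
  where
  open ≤-Reasoning
  A = suc c + d
  ab = A * suc c
  squeezed : 4 * ab + (1 + d) * (1 + d) ≤ 4 * (e + A)
  squeezed = begin
    4 * ab + (1 + d) * (1 + d)                              ≡⟨ ring c d ⟩
    (c + d + suc c) * ((c + d + suc c) * 1) + 4 * A         ≤⟨ +-monoˡ-≤ (4 * A) dense ⟩
    4 * e + 4 * A                                           ≡⟨ *-distribˡ-+ 4 e A ⟨
    4 * (e + A)                                             ∎
    where
    ring : ∀ c d → 4 * ((suc c + d) * suc c) + (1 + d) * (1 + d) ≡ (c + d + suc c) * ((c + d + suc c) * 1) + 4 * (suc c + d)
    ring = solve-∀
  ab<e+a : ab + 1 ≤ e + A
  ab<e+a = ≤-trans (≤-reflexive (+-comm ab 1)) (≰⇒> λ e+a≤ab → <⇒≱ (begin-strict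
    4 * (e + A)                    ≤⟨ *-monoʳ-≤ 4 e+a≤ab ⟩
    4 * ab                         <⟨ m<m+n (4 * ab) (s≤s z≤n) ⟩
    4 * ab + (1 + d) * (1 + d)     ∎) squeezed)
  [1+d]²≤4 : (1 + d) * (1 + d) ≤ 4
  [1+d]²≤4 = +-cancelˡ-≤ (4 * ab) _ _ (≤-trans squeezed (≤-trans (*-monoʳ-≤ 4 few) (≤-reflexive (*-distribˡ-+ 4 ab 1))))
  d≤1 : d ≤ 1
  d≤1 = ≮⇒≥ λ 1<d → <⇒≱ (≤-trans (s≤s (s≤s (s≤s (s≤s (s≤s z≤n))))) (*-mono-≤ (s≤s 1<d) (s≤s 1<d))) [1+d]²≤4
  3≤b : 3 ≤ suc c
  3≤b = ≮⇒≥ λ b<3 → <⇒≱ (begin-strict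
    suc c + d + suc c  ≤⟨ +-mono-≤ (+-mono-≤ (≤-pred b<3) d≤1) (≤-pred b<3) ⟩
    2 + 1 + 2          <⟨ ≤-refl ⟩
    6                  ∎) 6≤

-- Dense graphs with mp-number 2

module DenseGraph (G : Graph) (mp₂ : HasMpNumber G 2) (6≤N : 6 ≤ order G) (dense : (order G ∸ 1) ^ 2 ≤ 4 * size G) where

  private
    N = order G
    V = Vertex G

    sym-adj : ∀ {u v} → Adj G u v → Adj G v u
    sym-adj = Adj-sym G

    adj⇒≢ : ∀ {u v} → Adj G u v → u ≢ v
    adj⇒≢ uv refl = Adj-irrefl G uv

  module _ (side : V → Bool) (crosses : ∀ {u v} → Adj G u v → side u ≢ side v) where

    open Bipartite G side crosses

    private
      same-side : ∀ {s u v} → side u ≡ s → side v ≡ s → ¬ Adj G u v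
      same-side p q uv = crosses uv (trans p (sym q))

      -- Two full vertices on one side are twins, and a third vertex of that side lies outside their
      -- neighbourhood.
      full-unique-on : ∀ {s} → 3 ≤ part s → ∀ {u v} → side u ≡ s → side v ≡ s → Full u → Full v → u ≡ v
      full-unique-on {s} 3≤ {u} {v} p q full-u full-v with u ≟ v
      ... | yes u≡v = u≡v
      ... | no u≢v with #-third (On? s) u v 3≤
      ...   | w , r , w≢u , w≢v = ⊥-elim (twin-free G mp₂ u≢v w≢u w≢v (same-side p r)
        (λ uy → full-adjacent full-v (λ e → crosses uy (trans p (trans (sym q) e))))
        (λ vy → full-adjacent full-u (λ e → crosses vy (trans q (trans (sym p) e)))))

    -- Density forces equality in the count from the larger side. This supplies the apex and leaves
    -- each vertex of that side at most one missing neighbour.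
    larger-side-crown : part false ≤ part true → Crown G
    larger-side-crown b≤a = record
      { side           = side
      ; crosses        = crosses
      ; missing-unique = λ {u} → missing-unique (side u) refl
      ; full-unique    = λ {u} e → full-unique-on (3≤part (side u)) refl (sym e)
      ; apex           = proj₁ tight
      ; apex-side      = proj₁ (proj₂ tight)
      ; apex-full      = deg≡part⇒full (proj₁ (proj₂ tight)) (proj₁ (proj₂ (proj₂ tight)))
      }
      where
      6≤a+b : 6 ≤ part true + part false
      6≤a+b = subst (6 ≤_) (sym parts) 6≤N
      3≤a : 3 ≤ part true
      3≤a = ≮⇒≥ λ a<3 → <⇒≱ (+-mono-<-≤ a<3 (≤-trans b≤a (<⇒≤ a<3))) 6≤a+b
      numbers : 3 ≤ part false × part true * part false + 1 ≤ size G + part true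
      numbers = dense-bipartite b≤a 6≤a+b (subst (λ n → (n ∸ 1) ^ 2 ≤ 4 * size G) (sym parts) dense)
        (few-full true (full-unique-on 3≤a))
      3≤part : ∀ s → 3 ≤ part s
      3≤part true  = 3≤a
      3≤part false = proj₁ numbers
      tight : ∃ λ x → side x ≡ true × deg G x ≡ part false × (∀ {v} → side v ≡ true → part false ≤ suc (deg G v))
      tight = sumOver-tight (On? true) (deg G) (part false) deg≤part
        (λ p q e e′ → full-unique-on 3≤a p q (deg≡part⇒full p e) (deg≡part⇒full q e′))
        (≤-trans (proj₂ numbers) (≤-reflexive (cong (_+ part true) (sym (side-degrees true)))))
      missing-unique-left : ∀ {u v w} → side u ≡ true → Missing u v → Missing u w → v ≡ w
      missing-unique-left {u} p m k = #≤1 (Missing? u) (+-cancelˡ-≤ (deg G u) _ _ (begin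
        deg G u + # (Missing? u)  ≡⟨ deg+missing u p ⟨
        part false                ≤⟨ proj₂ (proj₂ (proj₂ tight)) p ⟩
        suc (deg G u)             ≡⟨ +-comm 1 (deg G u) ⟩
        deg G u + 1               ∎)) k m
        where open ≤-Reasoning
      missing-unique : ∀ s {u v w} → side u ≡ s → Missing u v → Missing u w → v ≡ w
      missing-unique true  p m k = missing-unique-left p m k
      -- Two missing neighbours `v` and `w` of `u` lie on the larger side, where each misses only
      -- `u`. They are therefore twins, with `u` outside their neighbourhood.
      missing-unique false {u} {v} {w} p m k with v ≟ w
      ... | yes v≡w = v≡w
      ... | no v≢w  = ⊥-elim (twin-free G mp₂ v≢w (λ { refl → proj₁ m refl }) (λ { refl → proj₁ k refl })
        (proj₂ m ∘ sym-adj) (dominates m k) (dominates k m))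
        where
        on-left : ∀ {x} → Missing u x → side x ≡ true
        on-left n = trans (≢-not (proj₁ n)) (cong not p)
        dominates : ∀ {x y} → Missing u x → Missing u y → Dominates G y x
        dominates {x} {y} m k {t} xt = adjacent (λ e → same-side (on-left m) (trans (sym e) (on-left k)) xt)
          λ n → proj₂ (missing-sym m) (subst (Adj G x) (missing-unique-left (on-left k) n (missing-sym k)) xt)

  bipartite-crown : (side : V → Bool) (crosses : ∀ {u v} → Adj G u v → side u ≢ side v) → Crown G
  bipartite-crown side crosses with ≤-total (part false) (part true)
    where open Bipartite G side crosses
  ... | inj₁ b≤a = larger-side-crown side crosses b≤a
  ... | inj₂ a≤b = larger-side-crown (not ∘ side) crosses′
    (subst₂ _≤_ (flip true) (flip false) a≤b)
    where
    crosses′ : ∀ {u v} → Adj G u v → not (side u) ≢ not (side v)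
    crosses′ uv e = crosses uv (Bool.not-injective e)
    flip : ∀ s → Bipartite.part G side crosses s ≡ Bipartite.part G (not ∘ side) crosses′ (not s)
    flip s = ≤-antisym
      (#-mono (λ v → side v Bool.≟ s) (λ v → not (side v) Bool.≟ not s) (cong not))
      (#-mono (λ v → not (side v) Bool.≟ not s) (λ v → side v Bool.≟ s) Bool.not-injective)

  two-classes-crown : {L : Pred V 0ℓ} → Decidable L → (∀ {x y} → Adj G x y → L x → L y → ⊥) →
                      (∀ {x y} → Adj G x y → ¬ L x → ¬ L y → ⊥) → Crown G
  two-classes-crown {L} L? inside-L outside-L = bipartite-crown (does ∘ L?) crosses
    where
    crosses : ∀ {x y} → Adj G x y → does (L? x) ≢ does (L? y)
    crosses {x} {y} xy e with L? x | L? y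
    ... | yes p | yes q = inside-L xy p q
    ... | no p  | no q  = outside-L xy p q

  -- Two members of `P` of degree `# T?` would both have neighbourhood `T`, so all but one have
  -- smaller degree. The second component is the case of equality.
  class-bound : {P T : Pred V 0ℓ} (P? : Decidable P) (T? : Decidable T) → (∀ {w} → P w → ∀ {y} → Adj G w y → T y) →
                (∀ {w w′} → P w → P w′ → w ≢ w′ → (∀ {y} → T y → Adj G w y) → (∀ {y} → T y → Adj G w′ y) → ⊥) →
                sumOver P? (deg G) + # P? ≤ # P? * # T? + 1 ×
                (# P? * # T? + 1 ≤ sumOver P? (deg G) + # P? →
                  (∃ λ x → P x × (∀ {y} → T y → Adj G x y)) × (∀ {w} → P w → # T? ≤ suc (deg G w)))
  class-bound {P} {T} P? T? N⊆T no-twins =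
    sumOver-≤ P? (deg G) (# T?) small unique ,
    λ large → let x , p , full , almost = sumOver-tight P? (deg G) (# T?) small unique large in (x , p , filled p full) , almost
    where
    small : ∀ {w} → P w → deg G w ≤ # T?
    small {w} p = #-mono (Adj? G w) T? (N⊆T p)
    filled : ∀ {w} → P w → deg G w ≡ # T? → ∀ {y} → T y → Adj G w y
    filled {w} p e = #-tight (Adj? G w) T? (N⊆T p) (≤-reflexive (sym e))
    unique : ∀ {w w′} → P w → P w′ → deg G w ≡ # T? → deg G w′ ≡ # T? → w ≡ w′
    unique {w} {w′} p q e e′ with w ≟ w′
    ... | yes w≡w′ = w≡w′
    ... | no w≢w′  = ⊥-elim (no-twins p q w≢w′ (filled p e) (filled q e′))

  Far Near : V → V → V → Set
  Far  z x w = Adj G x w × ¬ Adj G z w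
  Near z x w = Adj G x w × Adj G z w

  Far? : ∀ z x → Decidable (Far z x)
  Far? z x w = Adj? G x w ×-dec ¬? (Adj? G z w)

  Near? : ∀ z x → Decidable (Near z x)
  Near? z x w = Adj? G x w ×-dec Adj? G z w

  -- The edge u v satisfies N(u) ∪ N(v) = V \ {z}.  The lemmas below concern
  -- the side N(v); exchanging u and v gives those for N(u).
  record Exceptional (u v z : V) : Set where
    field
      uv    : Adj G u v
      z≁u   : ¬ Adj G z u
      z≁v   : ¬ Adj G z v
      cover : ∀ w → Adj G u w ⊎ Adj G v w ⊎ w ≡ z

    far-nbr : ∀ {w} → Far z v w → ∀ {y} → Adj G w y → Adj G u y
    far-nbr (vw , z≁w) {y} wy with cover y
    ... | inj₁ uy          = uy
    ... | inj₂ (inj₁ vy)   = ⊥-elim (triangle-free G mp₂ vw wy vy)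
    ... | inj₂ (inj₂ refl) = contradiction (sym-adj wy) z≁w

    -- The vertex `w` is adjacent to both `v` and `z`, so a neighbour of `w` adjacent to either of
    -- them would close a triangle.
    near-nbr : ∀ {w} → Near z v w → ∀ {y} → Adj G w y → Far z u y ⊎ y ≡ z
    near-nbr (vw , zw) {y} wy with cover y
    ... | inj₁ uy          = inj₁ (uy , triangle-free G mp₂ zw wy)
    ... | inj₂ (inj₁ vy)   = ⊥-elim (triangle-free G mp₂ vw wy vy)
    ... | inj₂ (inj₂ y≡z)  = inj₂ y≡z

    Far∪z? : Decidable (λ w → Far z u w ⊎ w ≡ z)
    Far∪z? w = Far? z u w ⊎-dec w ≟ z

    #Far∪z : # Far∪z? ≤ # (Far? z u) + 1
    #Far∪z = ≤-trans (#-cover Far∪z? (Far? z u) (_≟ z) id) (+-monoʳ-≤ (# (Far? z u)) (≤-reflexive (#-singleton z)))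

    z≢ : ∀ {w} → Adj G v w → w ≢ z
    z≢ vw refl = z≁v (sym-adj vw)

    -- Here `z` itself is the vertex outside the neighbourhood of the twins.
    far-bound = class-bound (Far? z v) (Adj? G u) far-nbr
      λ { p@(vw , z≁w) q@(vw′ , _) w≢w′ full full′ →
        twin-free G mp₂ w≢w′ (z≢ vw ∘ sym) (z≢ vw′ ∘ sym) (z≁w ∘ sym-adj) (full′ ∘ far-nbr p) (full ∘ far-nbr q) }

    -- The vertex outside the neighbourhood of the twins is `y`: being adjacent to `z`, it cannot be
    -- adjacent to a neighbour of `z`.
    near-bound : ∀ {y} → Near z u y → _
    near-bound (uy , zy) = class-bound (Near? z v) Far∪z? near-nbr
      λ { p@(vw , zw) q@(vw′ , _) w≢w′ full full′ →
        twin-free G mp₂ w≢w′ (λ { refl → triangle-free G mp₂ (sym-adj uv) uy vw }) (λ { refl → triangle-free G mp₂ (sym-adj uv) uy vw′ })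
          (λ wy → triangle-free G mp₂ zw wy zy) (full′ ∘ near-nbr p) (full ∘ near-nbr q) }

  exchange : ∀ {u v z} → Exceptional u v z → Exceptional v u z
  exchange ex = record
    { uv    = sym-adj uv
    ; z≁u   = z≁v
    ; z≁v   = z≁u
    ; cover = λ w → [ inj₂ ∘ inj₁ , [ inj₁ , inj₂ ∘ inj₂ ]′ ]′ (cover w)
    }
    where open Exceptional ex

  -- With x the vertex of N(v) other than u and c, and y the only neighbour of
  -- u not adjacent to x, the triple {x , u , z} or {y , y′ , c} lies on no path.
  no-order-7 : ∀ {u v z c y′} → Exceptional u v z → Near z v c → Near z u y′ → (∀ {w} → Far z v w ⊎ w ≡ z → Adj G y′ w) →
               # (Near? z v) ≤ 1 → # (Far? z v) ≡ 2 → deg G u ≤ 3 → (∀ {w} → Far z v w → deg G u ≤ suc (deg G w)) → ⊥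
  no-order-7 {u} {v} {z} {c} {y′} ex (vc , zc) (uy′ , zy′) y′-full #Near≤1 #Far≡2 deg-u≤3 almost-full
    with #-another (Far? z v) u (≤-reflexive (sym #Far≡2))
       where open Exceptional ex
  ... | x , far-x@(vx , z≁x) , x≢u = finish (any? missed?)
    where
    open Exceptional ex
    module Opposite-side = Exceptional (exchange ex)
    missed? : Decidable (λ w → Adj G u w × ¬ Adj G x w)
    missed? w = Adj? G u w ×-dec ¬? (Adj? G x w)
    #missed≤1 : # missed? ≤ 1
    #missed≤1 = +-cancelˡ-≤ (deg G x) _ _ (begin
      deg G x + # missed?                                    ≤⟨ +-monoˡ-≤ (# missed?) (#-mono (Adj? G x) (λ w → Adj? G u w ×-dec Adj? G x w) λ xw → far-nbr far-x xw , xw) ⟩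
      # (λ w → Adj? G u w ×-dec Adj? G x w) + # missed?      ≡⟨ #-split (Adj? G u) (Adj? G x) ⟨
      deg G u                                                ≤⟨ almost-full far-x ⟩
      suc (deg G x)                                          ≡⟨ +-comm 1 (deg G x) ⟩
      deg G x + 1                                            ∎)
      where open ≤-Reasoning
    far-two : ∀ {w} → Far z v w → w ≡ u ⊎ w ≡ x
    far-two = #≤2 (Far? z v) (≤-reflexive #Far≡2) (sym-adj uv , z≁u) far-x x≢u
    near-one : ∀ {w} → Near z v w → w ≡ c
    near-one = #≤1 (Near? z v) #Near≤1 (vc , zc)
    finish : Dec (∃ λ y → Adj G u y × ¬ Adj G x y) → ⊥
    -- If `x` misses no neighbour of `u`, then `x` and `u` are twins, with `z` outside their
    -- neighbourhood.
    finish (no none) = twin-free G mp₂ (x≢u ∘ sym) (z≢ (sym-adj uv) ∘ sym) (z≢ vx ∘ sym) (z≁u ∘ sym-adj)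
      (λ {w} uw → decidable-stable (Adj? G x w) λ x≁w → none (w , uw , x≁w)) (far-nbr far-x)
    finish (yes (y , uy , x≁y)) = by-class (Adj? G z y)
      where
      y≢v : y ≢ v
      y≢v refl = x≁y (sym-adj vx)
      y′≢v : y′ ≢ v
      y′≢v refl = z≁v zy′
      xy′ : Adj G x y′
      xy′ = sym-adj (y′-full (inj₁ far-x))
      y′≢y : y′ ≢ y
      y′≢y refl = x≁y xy′
      nbr-u : ∀ {w} → Adj G u w → w ≡ y ⊎ Adj G x w
      nbr-u {w} uw with Adj? G x w
      ... | yes xw = inj₂ xw
      ... | no x≁w = inj₁ (#≤1 missed? #missed≤1 (uy , x≁y) (uw , x≁w))
      nbr-x : ∀ {w} → Adj G x w → w ≡ v ⊎ w ≡ y′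
      nbr-x xw with #≤3 (Adj? G u) deg-u≤3 uv uy uy′ y≢v y′≢v y′≢y (far-nbr far-x xw)
      ... | inj₁ w≡v          = inj₁ w≡v
      ... | inj₂ (inj₁ refl)  = contradiction xw x≁y
      ... | inj₂ (inj₂ w≡y′)  = inj₂ w≡y′
      by-class : Dec (Adj G z y) → ⊥
      -- A path through x, u and z would start x, then v or y′, then u, y, c; but v is adjacent to
      -- c, and y′ to z.
      by-class (no z≁y) = no-detour G mp₂ x≢u (z≢ vx ∘ sym) (z≢ (sym-adj uv) ∘ sym) (z≁u ∘ sym-adj) (far-nbr far-x)
        nbr-x nbr-u nbr-y vc (sym-adj zy′)
        where
        nbr-y : ∀ {w} → Adj G y w → w ≡ u ⊎ w ≡ c
        nbr-y {w} yw with Opposite-side.far-nbr (uy , z≁y) yw | Adj? G z w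
        ... | vw | yes zw = inj₂ (near-one (vw , zw))
        ... | vw | no z≁w with far-two (vw , z≁w)
        ...   | inj₁ w≡u  = inj₁ w≡u
        ...   | inj₂ refl = contradiction (sym-adj yw) x≁y
      -- A path through y, y′ and c would start y, then u or z, then y′, x, v; but u is adjacent to
      -- v, and z to c.
      by-class (yes zy) = no-detour G mp₂ (y′≢y ∘ sym)
        (λ { refl → triangle-free G mp₂ uv vc uy }) (λ { refl → triangle-free G mp₂ uv vc uy′ })
        (λ y′c → triangle-free G mp₂ zy′ y′c zc)
        (y′-full ∘ Opposite-side.near-nbr (uy , zy))
        nbr-y nbr-y′ ([ inj₂ , inj₁ ]′ ∘ nbr-x) uv zc
        where
        nbr-y : ∀ {w} → Adj G y w → w ≡ u ⊎ w ≡ z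
        nbr-y yw with Opposite-side.near-nbr (uy , zy) yw
        ... | inj₂ w≡z = inj₂ w≡z
        ... | inj₁ far-w with far-two far-w
        ...   | inj₁ w≡u  = inj₁ w≡u
        ...   | inj₂ refl = contradiction (sym-adj yw) x≁y
        nbr-y′ : ∀ {w} → Adj G y′ w → w ≡ x ⊎ Adj G y w
        nbr-y′ y′w with Opposite-side.near-nbr (uy′ , zy′) y′w
        ... | inj₂ refl = inj₂ (sym-adj zy)
        ... | inj₁ far-w with far-two far-w
        ...   | inj₁ refl = inj₂ (sym-adj uy)
        ...   | inj₂ w≡x  = inj₁ w≡x

  module _ {u v z : V} (ex : Exceptional u v z) (N≡ : N ≡ suc (deg G u + deg G v)) where

    open Exceptional ex
    private
      module Opposite-side = Exceptional (exchange ex)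
      p  = # (Near? z v)
      p′ = # (Far? z v)
      q  = # (Near? z u)
      q′ = # (Far? z u)
      s  = (p + p′) + (q + q′)
      S₁ = sumOver (Far? z v) (deg G)
      S₂ = sumOver (Near? z v) (deg G)
      S₃ = sumOver (Far? z u) (deg G)
      S₄ = sumOver (Near? z u) (deg G)

      deg-v : deg G v ≡ p + p′
      deg-v = #-split (Adj? G v) (Adj? G z)

      deg-u : deg G u ≡ q + q′
      deg-u = #-split (Adj? G u) (Adj? G z)

      N≡1+s : N ≡ suc s
      N≡1+s = trans N≡ (cong suc (trans (+-comm (deg G u) (deg G v)) (cong₂ _+_ deg-v deg-u)))

      near-or-far : ∀ x {w} → Adj G x w → Far z x w ⊎ Near z x w
      near-or-far x {w} xw with Adj? G z w
      ... | yes zw = inj₂ (xw , zw)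
      ... | no z≁w = inj₁ (xw , z≁w)

      -- Every vertex other than `z` is in one of the four classes, and the neighbours of `z` are in
      -- the two near ones.
      degree-total : 2 * size G ≤ ((S₁ + S₂) + (S₃ + S₄)) + (p + q)
      degree-total = begin
        2 * size G                                    ≡⟨ handshake G ⟨
        sum (deg G)                                   ≤⟨ sum-mono (λ w → pointwise (deg G w) (𝟙 (Adj? G v w)) (𝟙 (Adj? G u w)) (𝟙 (w ≟ z)) (covered w)) ⟩
        sum (λ w → 𝟙 (Adj? G v w) * deg G w + (𝟙 (Adj? G u w) * deg G w + 𝟙 (w ≟ z) * deg G w))
          ≡⟨ trans (∑-distrib-+ (λ w → 𝟙 (Adj? G v w) * deg G w) _) (cong (sumOver (Adj? G v) (deg G) +_)
               (∑-distrib-+ (λ w → 𝟙 (Adj? G u w) * deg G w) (λ w → 𝟙 (w ≟ z) * deg G w))) ⟩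
        sumOver (Adj? G v) (deg G) + (sumOver (Adj? G u) (deg G) + sumOver (_≟ z) (deg G))
          ≤⟨ +-mono-≤ (sumOver-cover (Adj? G v) (Far? z v) (Near? z v) (deg G) (near-or-far v))
               (+-mono-≤ (sumOver-cover (Adj? G u) (Far? z u) (Near? z u) (deg G) (near-or-far u))
                 (≤-trans (sumOver-singleton z (deg G)) (#-cover (Adj? G z) (Near? z v) (Near? z u) nbr-z))) ⟩
        (S₁ + S₂) + ((S₃ + S₄) + (p + q))             ≡⟨ +-assoc (S₁ + S₂) (S₃ + S₄) (p + q) ⟨
        ((S₁ + S₂) + (S₃ + S₄)) + (p + q)             ∎
        where
        open ≤-Reasoning
        nbr-z : ∀ {w} → Adj G z w → Near z v w ⊎ Near z u w
        nbr-z {w} zw with cover w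
        ... | inj₁ uw          = inj₂ (uw , zw)
        ... | inj₂ (inj₁ vw)   = inj₁ (vw , zw)
        ... | inj₂ (inj₂ refl) = contradiction zw (Adj-irrefl G)
        covered : ∀ w → 1 ≤ 𝟙 (Adj? G v w) + (𝟙 (Adj? G u w) + 𝟙 (w ≟ z))
        covered w with cover w
        ... | inj₁ uw        = ≤-trans (≤-reflexive (sym (𝟙-yes (Adj? G u w) uw))) (≤-trans (m≤m+n (𝟙 (Adj? G u w)) (𝟙 (w ≟ z))) (m≤n+m _ (𝟙 (Adj? G v w))))
        ... | inj₂ (inj₁ vw) = ≤-trans (≤-reflexive (sym (𝟙-yes (Adj? G v w) vw))) (m≤m+n (𝟙 (Adj? G v w)) _)
        ... | inj₂ (inj₂ wz) = ≤-trans (≤-reflexive (sym (𝟙-yes (w ≟ z) wz))) (≤-trans (m≤n+m (𝟙 (w ≟ z)) (𝟙 (Adj? G u w))) (m≤n+m _ (𝟙 (Adj? G v w))))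
        pointwise : ∀ d i j k → 1 ≤ i + (j + k) → d ≤ i * d + (j * d + k * d)
        pointwise d i j k 1≤ = ≤-trans (≤-reflexive (sym (+-identityʳ d))) (≤-trans (*-monoˡ-≤ d 1≤) (≤-reflexive (ring d i j k)))
          where
          ring : ∀ d i j k → (i + (j + k)) * d ≡ i * d + (j * d + k * d)
          ring = solve-∀

    -- The numerical analysis leaves only seven vertices with all class bounds attained. Attainment
    -- provides the vertex `y′` and the nearly full far class on which `no-order-7` relies; if q
    -- rather than p is 1, `u` and `v` are exchanged.
    not-exceptional : ∀ {c y} → Near z v c → Near z u y → ⊥
    not-exceptional {c} {y} near-c near-y = seven (order-7 {e = size G} (#-∈ (Near? z v) near-c) (#-∈ (Far? z v) (sym-adj uv , z≁u))
        (#-∈ (Near? z u) near-y) (#-∈ (Far? z u) (uv , z≁v)) 5≤s dense′ few)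
      where
      open ≤-Reasoning
      open Bounds p p′ q q′
      5≤s : 5 ≤ s
      5≤s = ≤-pred (≤-trans 6≤N (≤-reflexive N≡1+s))
      dense′ : s * s ≤ 4 * size G
      dense′ = ≤-trans (≤-reflexive (cong (s *_) (sym (*-identityʳ s)))) (subst (λ n → (n ∸ 1) ^ 2 ≤ 4 * size G) N≡1+s dense)
      b₁ : S₁ + p′ ≤ bound₁
      b₁ = ≤-trans (proj₁ far-bound) (≤-reflexive (cong (λ d → p′ * d + 1) deg-u))
      c₂ : p * # Far∪z? + 1 ≤ bound₂
      c₂ = +-monoˡ-≤ 1 (*-monoʳ-≤ p #Far∪z)
      b₂ : S₂ + p ≤ bound₂
      b₂ = ≤-trans (proj₁ (near-bound near-y)) c₂
      b₃ : S₃ + q′ ≤ bound₃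
      b₃ = ≤-trans (proj₁ Opposite-side.far-bound) (≤-reflexive (cong (λ d → q′ * d + 1) deg-v))
      c₄ : q * # Opposite-side.Far∪z? + 1 ≤ bound₄
      c₄ = +-monoˡ-≤ 1 (*-monoʳ-≤ q Opposite-side.#Far∪z)
      b₄ : S₄ + q ≤ bound₄
      b₄ = ≤-trans (proj₁ (Opposite-side.near-bound near-c)) c₄
      shuffle : ((S₁ + S₂) + (S₃ + S₄)) + (p + q) + s ≡ ((S₁ + p′ + (S₂ + p)) + (S₃ + q′ + (S₄ + q))) + (p + q)
      shuffle = ring S₁ S₂ S₃ S₄ p p′ q q′
        where
        ring : ∀ a b c d p p′ q q′ → ((a + b) + (c + d)) + (p + q) + ((p + p′) + (q + q′)) ≡ ((a + p′ + (b + p)) + (c + q′ + (d + q))) + (p + q)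
        ring = solve-∀
      degree-total′ : 2 * size G + s ≤ ((S₁ + p′ + (S₂ + p)) + (S₃ + q′ + (S₄ + q))) + (p + q)
      degree-total′ = ≤-trans (+-monoˡ-≤ s degree-total) (≤-reflexive shuffle)
      few : 2 * size G + s ≤ total
      few = ≤-trans degree-total′ (+-monoˡ-≤ (p + q) (+-mono-≤ (+-mono-≤ b₁ b₂) (+-mono-≤ b₃ b₄)))
      two : ∀ {m n} → m ≡ 1 → m + n ≡ 3 → n ≡ 2
      two refl refl = refl
      seven : (p + p′ ≡ 3 × q + q′ ≡ 3 × (p ≡ 1 ⊎ q ≡ 1)) × total ≤ 2 * size G + s → ⊥
      -- `large` reverses the estimate `few`, so equality holds in each of the four summands.
      seven ((p+p′≡3 , q+q′≡3 , one) , large) with sum-tight (+-mono-≤ b₁ b₂) (+-mono-≤ b₃ b₄)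
                                              (+-cancelʳ-≤ (p + q) _ _ (≤-trans large degree-total′))
      ... | t₁₂ , t₃₄ with sum-tight b₁ b₂ t₁₂ | sum-tight b₃ b₄ t₃₄
      ...   | t₁ , t₂ | t₃ , t₄ with one
      ...     | inj₁ p≡1 with proj₂ (Opposite-side.near-bound near-c) (≤-trans c₄ t₄)
      ...       | (y′ , near-y′ , full) , _ = no-order-7 ex near-c near-y′ full (≤-reflexive p≡1) (two p≡1 p+p′≡3)
        (≤-reflexive (trans deg-u q+q′≡3)) (proj₂ (proj₂ far-bound (≤-trans (≤-reflexive (cong (λ d → p′ * d + 1) deg-u)) t₁)))
      seven ((p+p′≡3 , q+q′≡3 , one) , large) | t₁₂ , t₃₄ | t₁ , t₂ | t₃ , t₄ | inj₂ q≡1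
        with proj₂ (near-bound near-y) (≤-trans c₂ t₂)
      ...       | (y′ , near-y′ , full) , _ = no-order-7 (exchange ex) near-y near-y′ full (≤-reflexive q≡1) (two q≡1 q+q′≡3)
        (≤-reflexive (trans deg-v p+p′≡3)) (proj₂ (proj₂ Opposite-side.far-bound (≤-trans (≤-reflexive (cong (λ d → q′ * d + 1) deg-v)) t₃)))

  extremal-crown : Crown G
  extremal-crown = around (heavy-edge G (≤-trans (s≤s (s≤s z≤n)) 6≤N) dense)
    where
    around : (∃ λ u → ∃ λ v → Adj G u v × N ≤ suc (deg G u + deg G v)) → Crown G
    around (u , v , uv , heavy) = by-outside (any? outside?)
      where
      outside? : Decidable (λ w → ¬ Adj G u w × ¬ Adj G v w)
      outside? w = ¬? (Adj? G u w) ×-dec ¬? (Adj? G v w)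
      degrees+outside : (deg G u + deg G v) + # outside? ≡ N
      degrees+outside = trans (cong (_+ # outside?) (sym (∑-distrib-+ (λ w → 𝟙 (Adj? G u w)) (λ w → 𝟙 (Adj? G v w)))))
        (trans (sym (∑-distrib-+ (λ w → 𝟙 (Adj? G u w) + 𝟙 (Adj? G v w)) (λ w → 𝟙 (outside? w))))
          (trans (sum-cong-≗ one) (trans (sum-const N 1) (*-identityʳ N))))
        where
        one : ∀ w → 𝟙 (Adj? G u w) + 𝟙 (Adj? G v w) + 𝟙 (outside? w) ≡ 1
        one w with Adj? G u w | Adj? G v w
        ... | yes uw | yes vw = ⊥-elim (triangle-free G mp₂ uv vw uw)
        ... | yes _  | no _   = refl
        ... | no _   | yes _  = refl
        ... | no _   | no _   = refl
      #outside≤1 : # outside? ≤ 1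
      #outside≤1 = +-cancelˡ-≤ (deg G u + deg G v) _ _
        (≤-trans (≤-reflexive degrees+outside) (≤-trans heavy (≤-reflexive (+-comm 1 _))))
      inside-N : ∀ w {x y} → Adj G x y → Adj G w x → Adj G w y → ⊥
      inside-N w xy wx wy = triangle-free G mp₂ wx xy wy
      by-outside : Dec (∃ λ z → ¬ Adj G u z × ¬ Adj G v z) → Crown G
      by-outside (no none) = two-classes-crown (Adj? G v) (inside-N v)
        λ xy v≁x v≁y → inside-N u xy (in-N v≁x) (in-N v≁y)
        where
        in-N : ∀ {w} → ¬ Adj G v w → Adj G u w
        in-N {w} v≁w = decidable-stable (Adj? G u w) λ u≁w → none (w , u≁w , v≁w)
      by-outside (yes (z , u≁z , v≁z)) = by-nbrs (any? (Near? z v)) (any? (Near? z u))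
        where
        cover : ∀ w → Adj G u w ⊎ Adj G v w ⊎ w ≡ z
        cover w with Adj? G u w | Adj? G v w
        ... | yes uw | _      = inj₁ uw
        ... | no _   | yes vw = inj₂ (inj₁ vw)
        ... | no u≁w | no v≁w = inj₂ (inj₂ (#≤1 outside? #outside≤1 (u≁z , v≁z) (u≁w , v≁w)))
        N≡ : N ≡ suc (deg G u + deg G v)
        N≡ = ≤-antisym heavy (≤-trans (≤-reflexive (+-comm 1 _))
          (≤-trans (+-monoʳ-≤ (deg G u + deg G v) (#-∈ outside? (u≁z , v≁z))) (≤-reflexive degrees+outside)))
        by-nbrs : Dec (∃ (Near z v)) → Dec (∃ (Near z u)) → Crown G
        by-nbrs (yes (c , near-c)) (yes (y , near-y)) = ⊥-elim (not-exceptional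
          record { uv = uv ; z≁u = u≁z ∘ sym-adj ; z≁v = v≁z ∘ sym-adj ; cover = cover } N≡ near-c near-y)
        -- Here `z` has no neighbour in N(v) and joins that class.
        by-nbrs (no none) _ = two-classes-crown (λ w → Adj? G v w ⊎-dec w ≟ z)
          (λ { xy (inj₁ vx) (inj₁ vy)    → inside-N v xy vx vy
             ; xz (inj₁ vx) (inj₂ refl)  → none (_ , vx , sym-adj xz)
             ; zy (inj₂ refl) (inj₁ vy)  → none (_ , vy , zy)
             ; zz (inj₂ refl) (inj₂ refl) → Adj-irrefl G zz })
          λ xy ¬x ¬y → inside-N u xy (in-N ¬x) (in-N ¬y)
          where
          in-N : ∀ {w} → ¬ (Adj G v w ⊎ w ≡ z) → Adj G u w
          in-N {w} ¬w = [ id , (λ w∈ → contradiction w∈ ¬w) ]′ (cover w)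
        -- Here `z` has no neighbour in N(u) and joins the class of that set.
        by-nbrs (yes _) (no none) = two-classes-crown (Adj? G v) (inside-N v)
          λ xy v≁x v≁y → outside-v xy (in-N∪z v≁x) (in-N∪z v≁y)
          where
          in-N∪z : ∀ {w} → ¬ Adj G v w → Adj G u w ⊎ w ≡ z
          in-N∪z {w} v≁w with cover w
          ... | inj₁ uw          = inj₁ uw
          ... | inj₂ (inj₁ vw)   = contradiction vw v≁w
          ... | inj₂ (inj₂ w≡z)  = inj₂ w≡z
          outside-v : ∀ {x y} → Adj G x y → Adj G u x ⊎ x ≡ z → Adj G u y ⊎ y ≡ z → ⊥
          outside-v xy (inj₁ ux)   (inj₁ uy)   = inside-N u xy ux uy
          outside-v xz (inj₁ ux)   (inj₂ refl) = none (_ , ux , sym-adj xz)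
          outside-v zy (inj₂ refl) (inj₁ uy)   = none (_ , uy , zy)
          outside-v zz (inj₂ refl) (inj₂ refl) = Adj-irrefl G zz

-- The extremal number and the extremal graphs

⌈m/4⌉≥ : ∀ m → m ≤ 4 * ⌈ m / 4 ⌉
⌈m/4⌉≥ m = +-cancelʳ-≤ 3 m _ (begin
  m + 3                          ≡⟨ m≡m%n+[m/n]*n (m + 3) 4 ⟩
  (m + 3) % 4 + (m + 3) / 4 * 4  ≤⟨ +-monoˡ-≤ _ (≤-pred (m%n<n (m + 3) 4)) ⟩
  3 + (m + 3) / 4 * 4            ≡⟨ +-comm 3 _ ⟩
  (m + 3) / 4 * 4 + 3            ≡⟨ cong (_+ 3) (*-comm ((m + 3) / 4) 4) ⟩
  4 * ((m + 3) / 4) + 3          ∎)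
  where open ≤-Reasoning

⌈m/4⌉≤ : ∀ {m e} → 4 * e ≤ m → e ≤ ⌈ m / 4 ⌉
⌈m/4⌉≤ {m} {e} 4e≤m = begin
  e                ≡⟨ m*n/n≡m e 4 ⟨
  e * 4 / 4        ≤⟨ /-monoˡ-≤ 4 (≤-trans (≤-reflexive (*-comm e 4)) (≤-trans 4e≤m (m≤m+n m 3))) ⟩
  (m + 3) / 4      ∎
  where open ≤-Reasoning

module _ {n : ℕ} (6≤n : 6 ≤ n) where

  private
    mex : ℕ
    mex = ⌈ (n ∸ 1) ^ 2 / 4 ⌉

  -- A graph that is not dense is below the ceiling already, and a dense one is a crown, whose size
  -- is known exactly.
  size≤mex : ∀ G → order G ≡ n → HasMpNumber G 2 → size G ≤ mex
  size≤mex G refl mp₂ with (n ∸ 1) ^ 2 ≤? 4 * size G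
  ... | yes dense  = ≤-reflexive (crown-size (DenseGraph.extremal-crown G mp₂ 6≤n dense) (≤-trans (s≤s (s≤s z≤n)) 6≤n))
  ... | no  sparse = ⌈m/4⌉≤ (≰⇒≥ sparse)

  module _ {W : Graph} (crown : Crown W) (order≡n : order W ≡ n) where

    private
      mp₂ : HasMpNumber W 2
      mp₂ = crown-mp-number crown (subst (6 ≤_) (sym order≡n) 6≤n)

      size≡mex : size W ≡ mex
      size≡mex = trans (crown-size crown (≤-trans (s≤s (s≤s z≤n)) (subst (6 ≤_) (sym order≡n) 6≤n)))
        (cong (λ n → ⌈ (n ∸ 1) ^ 2 / 4 ⌉) order≡n)

    crown-isMex : IsMex n 2 mex
    crown-isMex = (W , order≡n , mp₂ , size≡mex) , size≤mex

    crown-extremal : IsUniqueUpToIso (IsExtremal n 2) W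
    crown-extremal = (order≡n , mp₂ , subst (IsMex n 2) (sym size≡mex) crown-isMex) , unique
      where
      unique : ∀ G → IsExtremal n 2 G → G ≅ W
      unique G (refl , mp₂G , _ , maximal) = crowns-isomorphic (DenseGraph.extremal-crown G mp₂G 6≤n dense) crown (sym order≡n)
        where
        -- Maximality of `G` is applied to the crown `W`, whose size is the ceiling of (n - 1)²/4.
        dense : (n ∸ 1) ^ 2 ≤ 4 * size G
        dense = ≤-trans (⌈m/4⌉≥ ((n ∸ 1) ^ 2)) (*-monoʳ-≤ 4 (≤-trans (≤-reflexive (sym size≡mex)) (maximal W order≡n mp₂)))

theorem3p6 : (n : ℕ) → 6 ≤ n →
    IsMex n 2 ⌈ (n ∸ 1) ^ 2 / 4 ⌉ ×
    (2 ∤ n → IsUniqueUpToIso (IsExtremal n 2) (T* n)) ×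
    (2 ∣ n → CrossNonEdge n × (∀ (e : CrossNonEdge n) → IsUniqueUpToIso (IsExtremal n 2) (T*+ n e)))
theorem3p6 n 6≤n =
  isMex (2 ∣? n) ,
  (λ 2∤n → crown-extremal 6≤n (T*-crown n 2∤n) (order-T* n)) ,
  λ 2∣n → cross , λ e → crown-extremal 6≤n (T*+-crown n 2∣n e) (order-T* n)
  where
  cross : CrossNonEdge n
  cross = crossNonEdge n (≤-trans (s≤s (s≤s z≤n)) 6≤n)
  isMex : Dec (2 ∣ n) → IsMex n 2 ⌈ (n ∸ 1) ^ 2 / 4 ⌉
  isMex (yes 2∣n) = crown-isMex 6≤n (T*+-crown n 2∣n cross) (order-T* n)
  isMex (no 2∤n)  = crown-isMex 6≤n (T*-crown n 2∤n) (order-T* n)
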